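{- Let $\mathcal{C}$ be a finite abstract simplicial complex, let $\mathcal{V}=\{V_1,\ldots,V_n\}$ be a partition of $V(\mathcal{C})$, and let $m,d\ge0$ be integers. If $\eta_H(\mathcal{C}[V_I])\ge|I|-d+m$ for all nonempty $I\subseteq[n]$ with $|I|\ge d$, where $V_I=\bigcup_{i\in I}V_i$, then $\eta_H(\mathbf{Col}(\mathcal{C},\mathcal{V};n-d))\ge m+1$.
   Context: $\mathcal{C}[X]=\{\sigma\in\mathcal{C}:\sigma\subseteq X\}$. $\eta_H(\mathcal{K})$ is $2$ plus the largest $k\ge-2$ with $\widetilde H_j(\mathcal{K};\mathbb{Q})=0$ for all $-1\le j\le k$ ($\widetilde H_{ -1}=0$ meaning $\mathcal{K}$ has a vertex), possibly $\infty$. $\mathbf{Col}(\mathcal{C},\mathcal{V};k)$ is the simplicial complex whose vertices are the simplices $\sigma\in\mathcal{C}$ that contain vertices from at least $k$ distinct classes of $\mathcal{V}$, and whose simplices are the chains $\sigma_1\subset\cdots\subset\sigma_\ell$ of such simplices. -}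

module Defs where

open import Algebra.Bundles using (CommutativeRing)
open import Data.Bool.Base using (Bool; if_then_else_)
open import Data.Fin.Base using (Fin; zero; suc)
import Data.Fin.Properties as Fin
open import Data.Fin.Subset
open import Data.Fin.Subset.Properties
open import Data.List.Base as List using (List; []; _∷_; allFin)
open import Data.List.Membership.Propositional using () renaming (_∈_ to _∈ₗ_)
import Data.List.Membership.Propositional.Properties as Mem
open import Data.List.Relation.Unary.Any using (here; there)
open import Data.Nat.Base as ℕ using (ℕ; zero; suc; _≤_; _<_; _^_)
import Data.Nat.Properties as ℕ
open import Data.Product using (∃; _×_; _,_; proj₁; proj₂)
open import Data.Product.Function.NonDependent.Propositional using (_×-↔_)
open import Data.Rational using (ℚ; 0ℚ; 1ℚ; -_; _+_; _*_; 1/_; ≢-nonZero) renaming (_-_ to _-ℚ_)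
import Data.Rational.Properties as ℚ
import Data.Rational.Solver as ℚ
open import Data.Sum using (_⊎_; inj₁; inj₂; [_,_]′)
open import Data.Vec.Base as Vec using (Vec; []; _∷_; tabulate)
import Data.Vec.Properties as Vec
import Data.Bool.Properties as Bool
open import Function.Base using (_∘_)
open import Function.Bundles using (_↔_; Inverse; mk↔ₛ′)
open import Function.Construct.Composition using (_↔-∘_)
open import Level using (0ℓ)
open import Relation.Binary.PropositionalEquality using (_≡_; _≢_; _≗_; refl; sym; trans; cong; cong₂; subst; module ≡-Reasoning)
open import Relation.Nullary using (¬_; Dec; yes; no; does; contradiction; _×-dec_; _⊎-dec_; _→-dec_; map′)
open import Relation.Nullary.Construct.Add.Supremum using (_⁺; ⊤⁺; [_])
open import Relation.Nullary.Decidable using (decidable-stable)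
open import Relation.Unary using (Pred; Decidable)

open import Algebra.Properties.Semiring.Sum
  (CommutativeRing.semiring ℚ.+-*-commutativeRing)
  using (sum-syntax; sum-cong-≗; ∑-distrib-+; *-distribˡ-sum)

-- The vertex set is {v | Face ⁅ v ⁆}; it need not be all of Fin N.  The
-- empty set always counts as a simplex (of dimension -1).
record SimplicialComplex (N : ℕ) : Set₁ where
  field
    Face   : Pred (Subset N) 0ℓ
    face?  : Decidable Face
    ⊥-face : Face ⊥
    closed : ∀ {σ τ} → τ ⊆ σ → Face σ → Face τ

open SimplicialComplex public

Vertex : ∀ {N} → SimplicialComplex N → Pred (Fin N) 0ℓ
Vertex C v = Face C ⁅ v ⁆

infix 8 _⟦_⟧

_⟦_⟧ : ∀ {N} → SimplicialComplex N → Subset N → SimplicialComplex N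
(C ⟦ X ⟧) .Face σ = Face C σ × σ ⊆ X
(C ⟦ X ⟧) .face? σ = face? C σ ×-dec (σ ⊆? X)
(C ⟦ X ⟧) .⊥-face = ⊥-face C , ⊥⊆
(C ⟦ X ⟧) .closed τ⊆σ (σ∈C , σ⊆X) = closed C τ⊆σ σ∈C , σ⊆X ∘ τ⊆σ

record IsPartition {N n} (C : SimplicialComplex N) (V : Fin n → Subset N) : Set where
  field
    nonempty : ∀ i → Nonempty (V i)
    disjoint : ∀ {i j v} → v ∈ V i → v ∈ V j → i ≡ j
    sound    : ∀ {i v} → v ∈ V i → Vertex C v
    cover    : ∀ {v} → Vertex C v → ∃ λ i → v ∈ V i

unionOver : ∀ {N n} → (Fin n → Subset N) → Subset n → Subset N
unionOver V I = ⋃ (List.map V (List.filter (_∈? I) (allFin _)))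

-- The subset with code x is given by the binary digits of x, so that S ⊂ T
-- implies that the code of S is smaller than that of T.
code : ∀ {N} → Fin (2 ^ N) ↔ Subset N
code {zero}  = mk↔ₛ′ (λ _ → []) (λ _ → zero) (λ { [] → refl }) (λ { zero → refl })
code {suc N} = ∷↔ ↔-∘ ((Fin.2↔Bool ×-↔ code) ↔-∘ Fin.*↔×)
  where
  ∷↔ : (Bool × Vec Bool N) ↔ Vec Bool (suc N)
  ∷↔ = mk↔ₛ′ (λ (b , S) → b ∷ S) Vec.uncons (λ { (_ ∷ _) → refl }) (λ _ → refl)

decode : ∀ {N} → Fin (2 ^ N) → Subset N
decode = Inverse.to code

classes : ∀ {N n} → (Fin n → Subset N) → Subset N → Subset n
classes V σ = tabulate (λ i → does (nonempty? (σ ∩ V i)))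

Colourful : ∀ {N n} → SimplicialComplex N → (Fin n → Subset N) → ℕ → Pred (Subset N) 0ℓ
Colourful C V k σ = Face C σ × k ≤ ∣ classes V σ ∣

Comparable : ∀ {N} → Subset N → Subset N → Set
Comparable σ τ = σ ⊆ τ ⊎ τ ⊆ σ

-- The vertex x : Fin (2 ^ N) stands for the simplex decode x of C.  For
-- k = 0 the empty simplex of C is one of the vertices.
Col : ∀ {N n} → SimplicialComplex N → (Fin n → Subset N) → ℕ → SimplicialComplex (2 ^ N)
Col {N} C V k = record
  { Face   = λ S → (∀ x → x ∈ S → Colourful C V k (decode x))
                 × (∀ x y → x ∈ S → y ∈ S → Comparable (decode {N} x) (decode {N} y))
  ; face?  = λ S →
      Fin.all? (λ x → (x ∈? S) →-dec (face? C (decode x) ×-dec (k ℕ.≤? ∣ classes V (decode x) ∣)))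
      ×-dec
      Fin.all? (λ x → map′ (λ f y p q → f p y q) (λ f p y q → f y p q)
        ((x ∈? S) →-dec Fin.all? (λ y → (y ∈? S) →-dec
          ((decode {N} x ⊆? decode {N} y) ⊎-dec (decode {N} y ⊆? decode {N} x)))))
  ; ⊥-face = (λ _ x∈⊥ → contradiction x∈⊥ ∉⊥) , (λ _ _ x∈⊥ → contradiction x∈⊥ ∉⊥)
  ; closed = λ τ⊆σ (vs , ch) → (λ x → vs x ∘ τ⊆σ) , (λ x y p q → ch x y (τ⊆σ p) (τ⊆σ q))
  }

Chain : ℕ → Set
Chain N = Subset N → ℚ

sgn : ℕ → ℚ
sgn zero    = 1ℚ
sgn (suc k) = - sgn k

-- The number of elements of σ smaller than v.
position : ∀ {N} → Fin N → Subset N → ℕ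
position zero    _             = 0
position (suc v) (inside  ∷ σ) = suc (position v σ)
position (suc v) (outside ∷ σ) = position v σ

-- With simplices oriented by the order of Fin N,
-- ∂ σ = Σ_{v ∈ σ} (-1)^(position v σ) (σ ∖ {v}).  So τ has a nonzero
-- coefficient in ∂ σ exactly when σ = τ ∪ {v} for some v ∉ τ, and then
-- position v σ = position v τ.
incidence : ∀ {N} → Fin N → Subset N → ℚ
incidence v τ = if does (v ∈? τ) then 0ℚ else sgn (position v τ)

∂ : ∀ {N} → Chain N → Chain N
∂ {N} c τ = ∑[ v < N ] (incidence v τ * c (τ ∪ ⁅ v ⁆))

-- Chains are graded by cardinality: p stands for dimension p - 1.
IsChain : ∀ {N} → SimplicialComplex N → ℕ → Pred (Chain N) 0ℓ
IsChain K p c = ∀ σ → c σ ≢ 0ℚ → Face K σ × ∣ σ ∣ ≡ p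

IsCycle : ∀ {N} → SimplicialComplex N → ℕ → Pred (Chain N) 0ℓ
IsCycle K p c = IsChain K p c × (∀ τ → ∂ c τ ≡ 0ℚ)

IsBoundary : ∀ {N} → SimplicialComplex N → ℕ → Pred (Chain N) 0ℓ
IsBoundary K p c = ∃ λ b → IsChain K (suc p) b × ∂ b ≗ c

-- H̃-vanishes K p says that the reduced homology of K in dimension p - 1 is 0.
H̃-vanishes : ∀ {N} → SimplicialComplex N → ℕ → Set
H̃-vanishes K p = ∀ c → IsCycle K p c → IsBoundary K p c

-- With r = k + 2: the reduced homology vanishes in dimensions -1, …, k.
Acyclic : ∀ {N} → SimplicialComplex N → ℕ → Set
Acyclic K r = ∀ p → p < r → H̃-vanishes K p

IsηH : ∀ {N} → SimplicialComplex N → ℕ ⁺ → Set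
IsηH K [ r ] = Acyclic K r × (∀ s → Acyclic K s → s ≤ r)
IsηH K ⊤⁺    = ∀ s → Acyclic K s

-- Gaussian elimination over ℚ decides H̃-vanishes K p; this is used only to
-- show that a value of ηH exists (ηH-exists).

module Elimination where

  open ℚ.+-*-Solver using (solve; con; _:=_; _:+_; _:*_; _:-_; :-_)

  abstract

    ring1 : ∀ x → x -ℚ 1ℚ * x ≡ 0ℚ
    ring1 = solve 1 (λ x → x :- con 1ℚ :* x := con 0ℚ) refl

    ring2 : ∀ x y z → x ≡ (x -ℚ (- y) * z) -ℚ y * z
    ring2 = solve 3 (λ x y z → x := (x :- (:- y) :* z) :- y :* z) refl

    ring3 : ∀ x y z → (x -ℚ y * z) -ℚ (- y) * z ≡ x
    ring3 = solve 3 (λ x y z → (x :- y :* z) :- (:- y) :* z := x) refl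

    ring4 : ∀ x y z u v w t → (x -ℚ y * z) -ℚ (u -ℚ y * v) * w * t ≡ (x -ℚ u * w * t) -ℚ y * (z -ℚ v * w * t)
    ring4 = solve 7 (λ x y z u v w t → (x :- y :* z) :- (u :- y :* v) :* w :* t := (x :- u :* w :* t) :- y :* (z :- v :* w :* t)) refl

    ring5 : ∀ x → x -ℚ x * 1ℚ ≡ 0ℚ
    ring5 = solve 1 (λ x → x :- x :* con 1ℚ := con 0ℚ) refl

    ring6 : ∀ x y → x -ℚ y * 0ℚ ≡ x
    ring6 = solve 2 (λ x y → x :- y :* con 0ℚ := x) refl

    ring7 : ∀ x y z → x -ℚ 0ℚ * y * z ≡ x
    ring7 = solve 3 (λ x y z → x :- con 0ℚ :* y :* z := x) refl

    ring8 : ∀ x y → x ≡ (x -ℚ y) + y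
    ring8 = solve 2 (λ x y → x := (x :- y) :+ y) refl

    ring9 : ∀ x y z u → (x -ℚ y * u) + z * u ≡ x -ℚ (y -ℚ z) * u
    ring9 = solve 4 (λ x y z u → (x :- y :* u) :+ z :* u := x :- (y :- z) :* u) refl

    ring10 : ∀ x → 0ℚ -ℚ x * 0ℚ ≡ 0ℚ
    ring10 = solve 1 (λ x → con 0ℚ :- x :* con 0ℚ := con 0ℚ) refl

    ring11 : ∀ x y → x ≡ x -ℚ 0ℚ * y
    ring11 = solve 2 (λ x y → x := x :- con 0ℚ :* y) refl

    ring12 : ∀ x → 0ℚ + x * 0ℚ ≡ 0ℚ
    ring12 = solve 1 (λ x → con 0ℚ :+ x :* con 0ℚ := con 0ℚ) refl

    ring13 : ∀ x y z u v w → (x -ℚ y * z) -ℚ u * w ≡ (x -ℚ (u + y * v) * w) -ℚ y * (z -ℚ v * w)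
    ring13 = solve 6 (λ x y z u v w → (x :- y :* z) :- u :* w := (x :- (u :+ y :* v) :* w) :- y :* (z :- v :* w)) refl

    ring14 : ∀ x y z → x ≡ (x -ℚ y * z) -ℚ (- y) * z
    ring14 = solve 3 (λ x y z → x := (x :- y :* z) :- (:- y) :* z) refl

    ring15 : ∀ x y z u → x * (y -ℚ z * u) ≡ x * y + (- z) * (x * u)
    ring15 = solve 4 (λ x y z u → x :* (y :- z :* u) := x :* y :+ (:- z) :* (x :* u)) refl

    ring16 : ∀ x y z → x + (- y) * z ≡ x -ℚ y * z
    ring16 = solve 3 (λ x y z → x :+ (:- y) :* z := x :- y :* z) refl

    ring17 : ∀ x y z → (x -ℚ (- y) * z) -ℚ (- y) * (- z) ≡ x
    ring17 = solve 3 (λ x y z → (x :- (:- y) :* z) :- (:- y) :* (:- z) := x) refl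

  infixl 6 _⊝_∙_

  _⊝_∙_ : {X : Set} → (X → ℚ) → ℚ → (X → ℚ) → (X → ℚ)
  (x ⊝ a ∙ g) i = x i -ℚ a * g i

  𝟎 : {X : Set} → X → ℚ
  𝟎 _ = 0ℚ

  Span : ∀ {X : Set} {n} → Vec (X → ℚ) n → (X → ℚ) → Set
  Span []       x = x ≗ 𝟎
  Span (g ∷ gs) x = ∃ λ a → Span gs (x ⊝ a ∙ g)

  record Linear {X Y : Set} (P : (X → ℚ) → (Y → ℚ)) : Set where
    field
      resp : ∀ {x y} → x ≗ y → P x ≗ P y
      lin  : ∀ x a g → P (x ⊝ a ∙ g) ≗ P x ⊝ a ∙ P g

    zer : ∀ {x} → x ≗ 𝟎 → P x ≗ 𝟎
    zer {x} x≗0 i = begin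
      P x i                ≡⟨ resp (λ j → trans (x≗0 j) (sym (trans (cong₂ (λ u v → u -ℚ 1ℚ * v) (x≗0 j) (x≗0 j)) refl))) i ⟩
      P (x ⊝ 1ℚ ∙ x) i     ≡⟨ lin x 1ℚ x i ⟩
      P x i -ℚ 1ℚ * P x i  ≡⟨ ring1 (P x i) ⟩
      0ℚ                   ∎
      where open ≡-Reasoning

  open Linear

  module _ {X : Set} where

    span-resp : ∀ {n} (gs : Vec (X → ℚ) n) {x y} → x ≗ y → Span gs x → Span gs y
    span-resp []       e s i   = trans (sym (e i)) (s i)
    span-resp (g ∷ gs) e (a , s) = a , span-resp gs (λ i → cong (_-ℚ a * g i) (e i)) s

  module _ {X : Set} where

    span-map : ∀ {Y : Set} {P : (X → ℚ) → (Y → ℚ)} → Linear P → ∀ {n} (gs : Vec (X → ℚ) n) {x} →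
               Span gs x → Span (Vec.map P gs) (P x)
    span-map L []       s       = zer L s
    span-map L (g ∷ gs) (a , s) = a , span-resp (Vec.map _ gs) (lin L _ a g) (span-map L gs s)

    span-unmap : ∀ {Y : Set} {P : (X → ℚ) → (Y → ℚ)} → Linear P → ∀ {n} (gs : Vec (X → ℚ) n) {w} →
                 Span (Vec.map P gs) w → ∃ λ y → Span gs y × P y ≗ w
    span-unmap L []       s = 𝟎 , (λ _ → refl) , λ i → trans (zer L (λ _ → refl) i) (sym (s i))
    span-unmap {P = P} L (g ∷ gs) {w} (a , s) with span-unmap L gs s
    ... | y , y∈ , e = z , (a , span-resp gs (λ i → z-a i) y∈) , ez
      where
      z : X → ℚ
      z = y ⊝ - a ∙ g
      z-a : ∀ i → y i ≡ (y i -ℚ (- a) * g i) -ℚ a * g i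
      z-a i = ring2 (y i) a (g i)
      ez : P z ≗ w
      ez i = trans (lin L y (- a) g i) (trans (cong (_-ℚ (- a) * P g i) (e i))
        (ring3 (w i) a (P g i)))

    span-elim : ∀ {Q : (X → ℚ) → Set} → (∀ {x} → x ≗ 𝟎 → Q x) →
                (∀ {x} a {g} → Q g → Q (x ⊝ a ∙ g) → Q x) →
                ∀ {n} (gs : Vec (X → ℚ) n) → (∀ j → Q (Vec.lookup gs j)) → ∀ {x} → Span gs x → Q x
    span-elim z c []       all s       = z s
    span-elim z c (g ∷ gs) all (a , s) = c a (all zero) (span-elim z c gs (all ∘ suc) s)

    pivot : (φ : (X → ℚ) → ℚ) (g : X → ℚ) → φ g ≢ 0ℚ → (X → ℚ) → (X → ℚ)
    pivot φ g ne h = h ⊝ (φ h * 1/ φ g) ∙ g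
      where instance _ = ≢-nonZero ne

    module Pivot {φ : (X → ℚ) → ℚ} (L : Linear {Y = X} (λ x _ → φ x)) {g : X → ℚ} (ne : φ g ≢ 0ℚ) (i₀ : X) where
      private instance nz = ≢-nonZero ne

      P : (X → ℚ) → (X → ℚ)
      P = pivot φ g ne

      linear : Linear P
      linear .resp e i = cong₂ (λ u v → u -ℚ v * 1/ φ g * g i) (e i) (resp L e i₀)
      linear .lin x a h i = trans (cong (λ u → (x i -ℚ a * h i) -ℚ u * 1/ φ g * g i) (lin L x a h i₀))
        (ring4 (x i) a (h i) (φ x) (φ h) (1/ φ g) (g i))

      φP : ∀ x → φ (P x) ≡ 0ℚ
      φP x = begin
        φ (P x)                        ≡⟨ lin L x (φ x * 1/ φ g) g i₀ ⟩
        φ x -ℚ φ x * 1/ φ g * φ g      ≡⟨ cong (φ x -ℚ_) (ℚ.*-assoc (φ x) (1/ φ g) (φ g)) ⟩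
        φ x -ℚ φ x * (1/ φ g * φ g)    ≡⟨ cong (λ u → φ x -ℚ φ x * u) (ℚ.*-inverseˡ (φ g)) ⟩
        φ x -ℚ φ x * 1ℚ                ≡⟨ ring5 (φ x) ⟩
        0ℚ                             ∎
        where open ≡-Reasoning

      Pg : P g ≗ 𝟎
      Pg i = begin
        g i -ℚ φ g * 1/ φ g * g i  ≡⟨ cong (λ u → g i -ℚ u * g i) (ℚ.*-inverseʳ (φ g)) ⟩
        g i -ℚ 1ℚ * g i            ≡⟨ ring1 (g i) ⟩
        0ℚ                         ∎
        where open ≡-Reasoning

      P⊝ : ∀ x a → P (x ⊝ a ∙ g) ≗ P x
      P⊝ x a i = trans (lin linear x a g i) (trans (cong (λ u → P x i -ℚ a * u) (Pg i))
        (ring6 (P x i) a))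

      P-fix : ∀ {x} → φ x ≡ 0ℚ → P x ≗ x
      P-fix {x} e i = trans (cong (λ u → x i -ℚ u * 1/ φ g * g i) e)
        (ring7 (x i) (1/ φ g) (g i))

  module Elim {X : Set} (_≟_ : (x y : X) → Dec (x ≡ y)) (enum : List X) (complete : ∀ x → x ∈ₗ enum) where

    zero? : ∀ (x : X → ℚ) → (∃ λ i → x i ≢ 0ℚ) ⊎ x ≗ 𝟎
    zero? x = [ inj₁ , (λ h → inj₂ (λ i → h i (complete i))) ]′ (go enum)
      where
      go : ∀ L → (∃ λ i → x i ≢ 0ℚ) ⊎ (∀ i → i ∈ₗ L → x i ≡ 0ℚ)
      go [] = inj₂ λ _ ()
      go (i ∷ L) with x i ℚ.≟ 0ℚ | go L
      ... | no ne | _       = inj₁ (i , ne)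
      ... | yes _ | inj₁ r  = inj₁ r
      ... | yes e | inj₂ h  = inj₂ λ { _ (here refl) → e ; j (there p) → h j p }

    eval-linear : ∀ i → Linear {X} {X} (λ x _ → x i)
    eval-linear i = record { resp = λ e _ → e i ; lin = λ _ _ _ _ → refl }

    span? : ∀ {n} (gs : Vec (X → ℚ) n) x → Dec (Span gs x)
    span? [] x with zero? x
    ... | inj₁ (i , ne) = no λ s → ne (s i)
    ... | inj₂ e        = yes e
    span? (g ∷ gs) x with zero? g
    ... | inj₂ e = map′ (λ s → 0ℚ , span-resp gs (λ i → sym (eq 0ℚ i)) s)
                        (λ (a , s) → span-resp gs (eq a) s) (span? gs x)
      where
      eq : ∀ a → x ⊝ a ∙ g ≗ x
      eq a i = trans (cong (λ u → x i -ℚ a * u) (e i))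
        (ring6 (x i) a)
    ... | inj₁ (i , ne) = map′ back
        (λ (a , s) → span-resp (Vec.map P gs) (P⊝ x a) (span-map linear gs s))
        (span? (Vec.map P gs) (P x))
      where
      open Pivot (eval-linear i) {g} ne i
      instance _ = ≢-nonZero ne
      back : Span (Vec.map P gs) (P x) → Span (g ∷ gs) x
      back s with span-unmap linear gs s
      ... | y , y∈ , e = x i * 1/ g i -ℚ y i * 1/ g i , span-resp gs eq y∈
        where
        eq : y ≗ x ⊝ (x i * 1/ g i -ℚ y i * 1/ g i) ∙ g
        eq j = begin
          y j                                        ≡⟨ ring8 (y j) (y i * 1/ g i * g j) ⟩
          P y j + y i * 1/ g i * g j                 ≡⟨ cong (_+ y i * 1/ g i * g j) (e j) ⟩
          P x j + y i * 1/ g i * g j                 ≡⟨ ring9 (x j) (x i * 1/ g i) (y i * 1/ g i) (g j) ⟩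
          x j -ℚ (x i * 1/ g i -ℚ y i * 1/ g i) * g j ∎
          where open ≡-Reasoning

    δ : X → X → ℚ
    δ i j = if does (i ≟ j) then 1ℚ else 0ℚ

    basis : (L : List X) → Vec (X → ℚ) (List.length L)
    basis []      = []
    basis (i ∷ L) = δ i ∷ basis L

    basis-∈ : ∀ L j → ∃ λ i → i ∈ₗ L × Vec.lookup (basis L) j ≡ δ i
    basis-∈ (i ∷ L) zero    = i , here refl , refl
    basis-∈ (i ∷ L) (suc j) = let k , k∈ , e = basis-∈ L j in k , there k∈ , e

    δ-supp : ∀ i j → δ i j ≢ 0ℚ → i ≡ j
    δ-supp i j ne with i ≟ j
    ... | yes e = e
    ... | no _  = contradiction refl ne

    span-basis : ∀ L x → (∀ i → x i ≢ 0ℚ → i ∈ₗ L) → Span (basis L) x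
    span-basis [] x supp i = decidable-stable (x i ℚ.≟ 0ℚ) λ ne → case (supp i ne)
      where
      case : ∀ {i} {A : Set} → i ∈ₗ [] → A
      case ()
    span-basis (i ∷ L) x supp = x i , span-basis L _ supp′
      where
      supp′ : ∀ j → x j -ℚ x i * δ i j ≢ 0ℚ → j ∈ₗ L
      supp′ j ne with i ≟ j
      ... | yes refl = contradiction
              (ring5 (x i)) ne
      ... | no i≢j with supp j (λ e → ne (trans (cong (λ u → u -ℚ x i * 0ℚ) e)
                     (ring10 (x i))))
      ...   | here refl = contradiction refl i≢j
      ...   | there p   = p

    module Kernel {D : (X → ℚ) → (X → ℚ)} (D-linear : Linear D) where

      functional : ∀ τ → Linear {X} {X} (λ x _ → D x τ)
      functional τ = record { resp = λ e _ → resp D-linear e τ ; lin = λ x a g _ → lin D-linear x a g τ }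

      record Cut {n} (gs : Vec (X → ℚ) n) (T : X → Set) : Set where
        field
          {size} : ℕ
          gens   : Vec (X → ℚ) size
          within : ∀ j → Span gs (Vec.lookup gens j)
          killed : ∀ j τ → T τ → D (Vec.lookup gens j) τ ≡ 0ℚ
          spans  : ∀ x → Span gs x → (∀ τ → T τ → D x τ ≡ 0ℚ) → Span gens x
      open Cut

      span-weaken : ∀ {n} g (gs : Vec (X → ℚ) n) {x} → Span gs x → Span (g ∷ gs) x
      span-weaken g gs {x} s = 0ℚ , span-resp gs
        (λ i → ring11 (x i) (g i)) s

      span-zero : ∀ {n} (gs : Vec (X → ℚ) n) {x} → x ≗ 𝟎 → Span gs x
      span-zero []       e = e
      span-zero (g ∷ gs) e = span-weaken g gs (span-zero gs e)

      span-sub : ∀ {n} (gs : Vec (X → ℚ) n) {x} a {h} → Span gs h → Span gs (x ⊝ a ∙ h) → Span gs x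
      span-sub [] {x} a {h} s t i = begin
        x i                        ≡⟨ ring8 (x i) (a * h i) ⟩
        (x i -ℚ a * h i) + a * h i ≡⟨ cong₂ (λ u v → u + a * v) (t i) (s i) ⟩
        0ℚ + a * 0ℚ                ≡⟨ ring12 a ⟩
        0ℚ                         ∎
        where open ≡-Reasoning
      span-sub (g ∷ gs) {x} a {h} (b , s) (c , t) = c + a * b ,
        span-sub gs a s (span-resp gs (λ i →
          ring13 (x i) a (h i) c b (g i)) t)

      span-gen : ∀ {n} (gs : Vec (X → ℚ) n) j → Span gs (Vec.lookup gs j)
      span-gen (g ∷ gs) zero    = 1ℚ , span-zero gs (λ i →
        ring1 (g i))
      span-gen (g ∷ gs) (suc j) = span-weaken g gs (span-gen gs j)

      span-trans : ∀ {m n} (gs : Vec (X → ℚ) n) (hs : Vec (X → ℚ) m) →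
                   (∀ j → Span gs (Vec.lookup hs j)) → ∀ {x} → Span hs x → Span gs x
      span-trans gs hs all = span-elim {Q = Span gs} (span-zero gs) (λ a → span-sub gs a) hs all

      D-sub : ∀ τ {x} a {g} → D g τ ≡ 0ℚ → D (x ⊝ a ∙ g) τ ≡ D x τ
      D-sub τ {x} a {g} e = trans (lin D-linear x a g τ) (trans (cong (λ u → D x τ -ℚ a * u) e)
        (ring6 (D x τ) a))

      cut₁ : ∀ {n} (gs : Vec (X → ℚ) n) τ → Cut gs (τ ≡_)
      cut₁ [] τ = record { gens = [] ; within = λ () ; killed = λ () ; spans = λ _ s _ → s }
      cut₁ (g ∷ gs) τ with D g τ ℚ.≟ 0ℚ
      ... | yes e = record
        { gens   = g ∷ gens C
        ; within = λ { zero → span-gen (g ∷ gs) zero ; (suc j) → span-weaken g gs (within C j) }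
        ; killed = λ { zero _ refl → e ; (suc j) → killed C j }
        ; spans  = λ { x (a , s) k → a , spans C _ s λ { _ refl → trans (D-sub τ a e) (k τ refl) } }
        }
        where C = cut₁ gs τ
      ... | no ne = record
        { gens   = Vec.map P gs
        ; within = λ j → subst (Span (g ∷ gs)) (sym (Vec.lookup-map j P gs))
            (let a = D (Vec.lookup gs j) τ * 1/ D g τ in
             - a , span-resp gs (λ i → ring14
                     (Vec.lookup gs j i) a (g i)) (span-gen gs j))
        ; killed = λ { j _ refl → trans (cong (λ h → D h τ) (Vec.lookup-map j P gs)) (φP (Vec.lookup gs j)) }
        ; spans  = λ { x (a , s) k → span-resp (Vec.map P gs)
            (λ i → trans (P⊝ x a i) (P-fix (k τ refl) i)) (span-map linear gs s) }
        }
        where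
        open Pivot (functional τ) {g} ne τ
        instance _ = ≢-nonZero ne

      cut : ∀ {n} (gs : Vec (X → ℚ) n) L → Cut gs (_∈ₗ L)
      cut gs [] = record { gens = gs ; within = span-gen gs ; killed = λ _ _ () ; spans = λ _ s _ → s }
      cut gs (τ ∷ L) = record
        { gens   = gens C₂
        ; within = λ j → span-trans gs (gens C₁) (within C₁) (within C₂ j)
        ; killed = λ { j _ (here refl) → span-elim {Q = λ x → D x τ ≡ 0ℚ} (λ e → zer D-linear e τ)
                         (λ a e f → trans (sym (D-sub τ a e)) f)
                         (gens C₁) (λ j → killed C₁ j τ refl) (within C₂ j)
                     ; j σ (there p) → killed C₂ j σ p }
        ; spans  = λ x s k → spans C₂ x (spans C₁ x s λ { _ refl → k τ (here refl) }) (λ σ p → k σ (there p))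
        }
        where
        C₁ = cut₁ gs τ
        C₂ = cut (gens C₁) L

  ∂-linear : ∀ {N} → Linear (∂ {N})
  ∂-linear {N} .resp e τ = sum-cong-≗ {N} (λ v → cong (incidence v τ *_) (e (τ ∪ ⁅ v ⁆)))
  ∂-linear {N} .lin x a g τ = begin
    ∑[ v < N ] (ι v * (x (s v) -ℚ a * g (s v)))
      ≡⟨ sum-cong-≗ {N} (λ v → ring15 (ι v) (x (s v)) a (g (s v))) ⟩
    ∑[ v < N ] (ι v * x (s v) + (- a) * (ι v * g (s v)))
      ≡⟨ ∑-distrib-+ {N} (λ v → ι v * x (s v)) (λ v → (- a) * (ι v * g (s v))) ⟩
    ∂ x τ + (∑[ v < N ] ((- a) * (ι v * g (s v))))
      ≡⟨ cong (∂ x τ +_) (sym (*-distribˡ-sum {N} (- a) (λ v → ι v * g (s v)))) ⟩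
    ∂ x τ + (- a) * ∂ g τ
      ≡⟨ ring16 (∂ x τ) a (∂ g τ) ⟩
    ∂ x τ -ℚ a * ∂ g τ ∎
    where
    open ≡-Reasoning
    ι = λ v → incidence v τ
    s = λ v → τ ∪ ⁅ v ⁆

  subsets : ∀ N → List (Subset N)
  subsets N = List.map decode (allFin (2 ^ N))

  ∈-subsets : ∀ {N} (S : Subset N) → S ∈ₗ subsets N
  ∈-subsets S = subst (_∈ₗ subsets _) (Inverse.strictlyInverseˡ code S)
    (Mem.∈-map⁺ decode (Mem.∈-allFin (Inverse.from code S)))

  module Vanishing {N} (K : SimplicialComplex N) where

    open Elim (Vec.≡-dec Bool._≟_) (subsets N) ∈-subsets
    open Kernel (∂-linear {N})

    simplex? : ∀ p → Decidable (λ σ → Face K σ × ∣ σ ∣ ≡ p)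
    simplex? p σ = face? K σ ×-dec (∣ σ ∣ ℕ.≟ p)

    simplices : ℕ → List (Subset N)
    simplices p = List.filter (simplex? p) (subsets N)

    chain⇒span : ∀ p {c} → IsChain K p c → Span (basis (simplices p)) c
    chain⇒span p {c} h = span-basis (simplices p) c
      λ σ ne → Mem.∈-filter⁺ (simplex? p) (∈-subsets σ) (h σ ne)

    chain-zero : ∀ p {c} → c ≗ 𝟎 → IsChain K p c
    chain-zero p e σ ne = contradiction (e σ) ne

    chain-sub : ∀ p {x} a {g} → IsChain K p g → IsChain K p (x ⊝ a ∙ g) → IsChain K p x
    chain-sub p {x} a {g} hg hx σ ne with g σ ℚ.≟ 0ℚ
    ... | no ne′ = hg σ ne′
    ... | yes e  = hx σ λ z → ne (trans (sym (trans (cong (λ u → x σ -ℚ a * u) e)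
                     (ring6 (x σ) a))) z)

    span⇒chain : ∀ p {c} → Span (basis (simplices p)) c → IsChain K p c
    span⇒chain p = span-elim {Q = IsChain K p} (chain-zero p) (chain-sub p) (basis (simplices p)) λ j →
      let i , i∈ , e = basis-∈ (simplices p) j in
      subst (IsChain K p) (sym e) λ σ ne →
        subst (λ σ → Face K σ × ∣ σ ∣ ≡ p) (δ-supp i σ ne)
          (proj₂ (Mem.∈-filter⁻ (simplex? p) {xs = subsets N} i∈))

    boundary? : ∀ p c → Dec (IsBoundary K p c)
    boundary? p c = map′
      (λ s → let b , b∈ , e = span-unmap ∂-linear bs s in b , span⇒chain (suc p) b∈ , e)
      (λ (b , h , e) → span-resp (Vec.map ∂ bs) e (span-map ∂-linear bs (chain⇒span (suc p) h)))
      (span? (Vec.map ∂ bs) c)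
      where bs = basis (simplices (suc p))

    boundary-sub : ∀ p {x} a {g} → IsBoundary K p g → IsBoundary K p (x ⊝ a ∙ g) → IsBoundary K p x
    boundary-sub p {x} a {g} (b , hb , eb) (c , hc , ec) =
      c ⊝ - a ∙ b , chain-sub (suc p) (- a) hb′ hc′ , λ i →
        trans (lin ∂-linear c (- a) b i) (trans (cong₂ (λ u v → u -ℚ (- a) * v) (ec i) (eb i))
          (ring3 (x i) a (g i)))
      where
      hb′ : IsChain K (suc p) (λ σ → - b σ)
      hb′ σ ne = hb σ λ e → ne (cong -_ e)
      hc′ : IsChain K (suc p) ((c ⊝ - a ∙ b) ⊝ - a ∙ (λ σ → - b σ))
      hc′ σ ne = hc σ λ e → ne (trans
        (ring17 (c σ) a (b σ)) e)

    boundary-zero : ∀ p {x} → x ≗ 𝟎 → IsBoundary K p x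
    boundary-zero p e = 𝟎 , chain-zero (suc p) (λ _ → refl) ,
      λ i → trans (zer ∂-linear (λ _ → refl) i) (sym (e i))

    vanishes? : ∀ p → Dec (H̃-vanishes K p)
    vanishes? p = map′
      (λ all c (hc , z) → span-elim {Q = IsBoundary K p} (boundary-zero p) (boundary-sub p) gens all
         (spans c (chain⇒span p hc) (λ τ _ → z τ)))
      (λ h j → h _ (span⇒chain p (within j) , λ τ → killed j τ (∈-subsets τ)))
      (Fin.all? (λ j → boundary? p (Vec.lookup gens j)))
      where open Cut (cut (basis (simplices p)) (subsets N))

    vanishes-above : ∀ p → N < p → H̃-vanishes K p
    vanishes-above p N<p c (hc , _) = boundary-zero p λ σ → decidable-stable (c σ ℚ.≟ 0ℚ) λ ne →
      ℕ.<⇒≱ N<p (subst (_≤ N) (proj₂ (hc σ ne)) (∣p∣≤n σ))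

    search : ∀ r → Acyclic K r ⊎ ∃ λ s → Acyclic K s × ¬ H̃-vanishes K s
    search zero = inj₁ λ _ ()
    search (suc r) with search r
    ... | inj₂ f = inj₂ f
    ... | inj₁ a with vanishes? r
    ...   | no ¬v = inj₂ (r , a , ¬v)
    ...   | yes v = inj₁ λ p p<1+r → [ a p , (λ { refl → v }) ]′ (ℕ.m≤n⇒m<n∨m≡n (ℕ.≤-pred p<1+r))

open Elimination using (module Vanishing)

abstract

  ηH-exists : ∀ {N} (K : SimplicialComplex N) → ∃ (IsηH K)
  ηH-exists {N} K with search (suc N)
    where open Vanishing K
  ... | inj₁ a = ⊤⁺ , λ s p _ → [ Vanishing.vanishes-above K p , (λ p≤N → a p (ℕ.s≤s p≤N)) ]′ (ℕ.<-≤-connex N p)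
  ... | inj₂ (r , a , ¬v) = [ r ] , a , λ s b → ℕ.≮⇒≥ λ r<s → ¬v (b r r<s)

ηH : ∀ {N} → SimplicialComplex N → ℕ ⁺
ηH K = proj₁ (ηH-exists K)

ηH-spec : ∀ {N} (K : SimplicialComplex N) → IsηH K (ηH K)
ηH-spec K = proj₂ (ηH-exists K)

open import Relation.Binary.Construct.Add.Supremum.NonStrict _≤_ public using (_≤⁺_)

{-# OPTIONS --safe #-}

-- Let X i be the order complex of the simplices of C that meet V i.  As a chain of simplices
-- meets V i as soon as its least member does, the union of the X i over i ∈ I is the order
-- complex of the simplices meeting V_I, and Col C V k consists of the chains that lie in at
-- least k of the X i.
--
-- The order complex of the simplices meeting W has the homology of C ⟦ W ⟧: both are obtained
-- by collapsing the complex of pairs (τ, S), where τ is a simplex of C ⟦ W ⟧ and S a chain of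
-- simplices that contain τ and meet W.  A pair with S nonempty is matched by toggling in τ a
-- vertex of W common to all members of S; a pair with τ nonempty by toggling τ in S.
--
-- It remains to see that, for arbitrary complexes X i, acyclicity of the unions of the X i passes
-- to the complex T_k(X) of the simplices in at least k of them.  For k = 1 this is a union.
-- In general T_k(X₀, X₁, …) = T_{k-1}(X₁, …) ∩ (X₀ ∪ T_k(X₁, …)), where the second term and the
-- union of the two terms are threshold complexes of the family X₀ ∪ X₁, X₀ ∪ X₂, …, so that
-- induction on the number of complexes and Mayer–Vietoris apply.

module Submission where

open import Defs
open import Algebra.Bundles using (CommutativeRing)
open import Data.Bool.Base using (true; false)
import Data.Bool.Properties as Bool
open import Data.Fin.Base using (Fin; zero; suc; _↑ˡ_; _↑ʳ_)
import Data.Fin.Properties as Fin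
open import Data.Fin.Subset using (Subset; _-_; _∩_; ⋃; Nonempty; ∣_∣; inside; outside; ⁅_⁆; _∪_; _∈_; _∉_; _⊆_; ⊥; ⊤)
open import Data.Fin.Subset.Properties
open import Data.List.Base using (List; []; _∷_; allFin)
open import Data.List.Membership.Propositional using () renaming (_∈_ to _∈ₗ_)
import Data.List.Membership.Propositional.Properties as Mem
import Data.List.Relation.Unary.Any as Any
open import Data.Nat.Base using (ℕ; zero; suc; _+_; _∸_; _≤_; _<_; z≤n; s≤s; _^_)
import Data.Nat.Properties as ℕ
open import Data.Product using (∃; _×_; _,_; proj₁; proj₂)
open import Data.Rational using (ℚ; 0ℚ; 1ℚ) renaming (_+_ to _+ℚ_; _-_ to _-ℚ_; _*_ to _*ℚ_; -_ to ⊖_)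
import Data.Rational.Properties as ℚ
import Data.Rational.Solver as ℚ
open import Data.Sum as Sum using (_⊎_; inj₁; inj₂; [_,_]′)
open import Data.Vec.Base as Vec using (_∷_; []; here; there; tabulate; take; drop; _++_)
import Data.Vec.Properties as Vec
open import Function.Base using (_∘_)
open import Function.Bundles using (Inverse)
open import Relation.Binary.PropositionalEquality using (_≡_; _≢_; _≗_; refl; sym; trans; cong; cong₂; subst; module ≡-Reasoning)
open import Relation.Nullary using (¬_; Dec; yes; no; does; contradiction; _×-dec_; _⊎-dec_; _→-dec_; ¬?; map′)
open import Relation.Nullary.Construct.Add.Supremum using ([_]; ⊤⁺)
import Relation.Binary.Construct.Add.Supremum.NonStrict _≤_ as Sup
open import Relation.Nullary.Decidable using (decidable-stable; dec-true; dec-false)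

open import Algebra.Properties.Semiring.Sum
  (CommutativeRing.semiring ℚ.+-*-commutativeRing)
  using (sum; sum-cong-≗; *-distribˡ-sum)

open Elimination using (Linear; 𝟎; ∂-linear)
open Linear using (resp; lin; zer)

private
  variable
    N M : ℕ

-- Rational arithmetic and linear maps of chains

module RationalIdentities where

  open ℚ.+-*-Solver using (solve; con; _:=_; _:+_; _:*_; _:-_; :-_)

  abstract

    add-as-sub : ∀ x y → x +ℚ y ≡ x -ℚ (⊖ 1ℚ) *ℚ y
    add-as-sub = solve 2 (λ x y → x :+ y := x :- (:- con 1ℚ) :* y) refl

    neg-as-sub : ∀ x → ⊖ x ≡ 0ℚ -ℚ 1ℚ *ℚ x
    neg-as-sub = solve 1 (λ x → :- x := con 0ℚ :- con 1ℚ :* x) refl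

    sub-as-sub : ∀ x y → x -ℚ y ≡ x -ℚ 1ℚ *ℚ y
    sub-as-sub = solve 2 (λ x y → x :- y := x :- con 1ℚ :* y) refl

    neg-as-mul : ∀ x → ⊖ x ≡ (⊖ 1ℚ) *ℚ x
    neg-as-mul = solve 1 (λ x → :- x := (:- con 1ℚ) :* x) refl

    neg-mul : ∀ x y → (⊖ x) *ℚ y ≡ (⊖ 1ℚ) *ℚ (x *ℚ y)
    neg-mul = solve 2 (λ x y → (:- x) :* y := (:- con 1ℚ) :* (x :* y)) refl

    neg-lin : ∀ x a y → ⊖ (x -ℚ a *ℚ y) ≡ (⊖ x) -ℚ a *ℚ (⊖ y)
    neg-lin = solve 3 (λ x a y → :- (x :- a :* y) := (:- x) :- a :* (:- y)) refl

    zero-lin : ∀ a → 0ℚ ≡ 0ℚ -ℚ a *ℚ 0ℚ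
    zero-lin = solve 1 (λ a → con 0ℚ := con 0ℚ :- a :* con 0ℚ) refl

    neg-cancel : ∀ x y → ⊖ x +ℚ (x +ℚ y) ≡ y
    neg-cancel = solve 2 (λ x y → :- x :+ (x :+ y) := y) refl

    neg-cancelʳ : ∀ x y → ⊖ x +ℚ (y +ℚ x) ≡ y
    neg-cancelʳ = solve 2 (λ x y → :- x :+ (y :+ x) := y) refl

    neg-cancelˡ : ∀ x y z → (⊖ x +ℚ y) +ℚ (x +ℚ z) ≡ y +ℚ z
    neg-cancelˡ = solve 3 (λ x y z → (:- x :+ y) :+ (x :+ z) := y :+ z) refl

    neg-neg : ∀ x → ⊖ (⊖ x) ≡ x
    neg-neg = solve 1 (λ x → :- (:- x) := x) refl

    sub-zero : ∀ x → x -ℚ 0ℚ ≡ x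
    sub-zero = solve 1 (λ x → x :- con 0ℚ := x) refl

    sub-self : ∀ x → x -ℚ x ≡ 0ℚ
    sub-self = solve 1 (λ x → x :- x := con 0ℚ) refl

    add-sub : ∀ x y → x +ℚ (y -ℚ x) ≡ y
    add-sub = solve 2 (λ x y → x :+ (y :- x) := y) refl

    sub-transfer : ∀ a b x → a -ℚ x ≡ b -ℚ (x -ℚ (a -ℚ b))
    sub-transfer = solve 3 (λ a b x → a :- x := b :- (x :- (a :- b))) refl

open RationalIdentities

module _ {X Y : Set} {P : (X → ℚ) → (Y → ℚ)} (L : Linear P) where

  linear-+ : ∀ x y → P (λ i → x i +ℚ y i) ≗ λ i → P x i +ℚ P y i
  linear-+ x y i = trans (resp L (λ j → add-as-sub (x j) (y j)) i)
    (trans (lin L x (⊖ 1ℚ) y i) (sym (add-as-sub (P x i) (P y i))))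

  linear-- : ∀ x y → P (λ i → x i -ℚ y i) ≗ λ i → P x i -ℚ P y i
  linear-- x y i = trans (resp L (λ j → sub-as-sub (x j) (y j)) i)
    (trans (lin L x 1ℚ y i) (sym (sub-as-sub (P x i) (P y i))))

  linear-neg : ∀ x → P (λ i → ⊖ x i) ≗ λ i → ⊖ P x i
  linear-neg x i = trans (resp L (λ j → neg-as-sub (x j)) i)
    (trans (lin L 𝟎 1ℚ x i)
      (trans (cong (_-ℚ 1ℚ *ℚ P x i) (zer L (λ _ → refl) i)) (sym (neg-as-sub (P x i)))))

-- The boundary operator and the cone

∂-outside : ∀ (c : Chain (suc N)) τ → ∂ c (outside ∷ τ) ≡ c (inside ∷ τ) +ℚ ∂ (c ∘ (outside ∷_)) τ
∂-outside c τ = cong (_+ℚ ∂ (c ∘ (outside ∷_)) τ)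
  (trans (ℚ.*-identityˡ _) (cong (λ ρ → c (inside ∷ ρ)) (∪-identityʳ τ)))

-- The summand of vertex `zero` vanishes because `zero` already belongs to the simplex. As `zero`
-- precedes every other vertex, all other positions shift by one, which gives the sign.
∂-inside : ∀ (c : Chain (suc N)) τ → ∂ c (inside ∷ τ) ≡ ⊖ ∂ (c ∘ (inside ∷_)) τ
∂-inside {N} c τ = begin
  0ℚ *ℚ c (inside ∷ τ ∪ ⊥) +ℚ sum {N} (λ v → incidence (suc v) (inside ∷ τ) *ℚ c (inside ∷ τ ∪ ⁅ v ⁆))
    ≡⟨ cong (_+ℚ sum {N} (λ v → incidence (suc v) (inside ∷ τ) *ℚ c (inside ∷ τ ∪ ⁅ v ⁆))) (ℚ.*-zeroˡ (c (inside ∷ τ ∪ ⊥))) ⟩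
  0ℚ +ℚ sum {N} (λ v → incidence (suc v) (inside ∷ τ) *ℚ c (inside ∷ τ ∪ ⁅ v ⁆))
    ≡⟨ ℚ.+-identityˡ _ ⟩
  sum {N} (λ v → incidence (suc v) (inside ∷ τ) *ℚ c (inside ∷ τ ∪ ⁅ v ⁆))
    ≡⟨ sum-cong-≗ {N} (λ v → trans (cong (_*ℚ c (inside ∷ τ ∪ ⁅ v ⁆)) (incidence-inside v))
         (neg-mul (incidence v τ) _)) ⟩
  sum {N} (λ v → (⊖ 1ℚ) *ℚ (incidence v τ *ℚ c (inside ∷ τ ∪ ⁅ v ⁆)))
    ≡⟨ *-distribˡ-sum {N} (⊖ 1ℚ) (λ v → incidence v τ *ℚ c (inside ∷ τ ∪ ⁅ v ⁆)) ⟨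
  (⊖ 1ℚ) *ℚ ∂ (c ∘ (inside ∷_)) τ
    ≡⟨ neg-as-mul _ ⟨
  ⊖ ∂ (c ∘ (inside ∷_)) τ ∎
  where
  open ≡-Reasoning
  incidence-inside : ∀ v → incidence (suc v) (inside ∷ τ) ≡ ⊖ incidence v τ
  incidence-inside v with does (v ∈? τ)
  ... | true  = refl
  ... | false = refl

-- Induction on the number of vertices, splitting a chain by whether `zero` is in the simplex: the
-- two mixed terms cancel because of the sign in `∂-inside`.
∂∂≡0 : ∀ (c : Chain N) → ∂ (∂ c) ≗ 𝟎
∂∂≡0 {zero}  c [] = refl
∂∂≡0 {suc N} c (outside ∷ τ) = begin
  ∂ (∂ c) (outside ∷ τ)
    ≡⟨ ∂-outside (∂ c) τ ⟩
  ∂ c (inside ∷ τ) +ℚ ∂ (∂ c ∘ (outside ∷_)) τ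
    ≡⟨ cong₂ _+ℚ_ (∂-inside c τ) (trans (resp ∂-linear (∂-outside c) τ) (linear-+ ∂-linear (c ∘ (inside ∷_)) (∂ (c ∘ (outside ∷_))) τ)) ⟩
  ⊖ ∂ (c ∘ (inside ∷_)) τ +ℚ (∂ (c ∘ (inside ∷_)) τ +ℚ ∂ (∂ (c ∘ (outside ∷_))) τ)
    ≡⟨ neg-cancel (∂ (c ∘ (inside ∷_)) τ) (∂ (∂ (c ∘ (outside ∷_))) τ) ⟩
  ∂ (∂ (c ∘ (outside ∷_))) τ
    ≡⟨ ∂∂≡0 (c ∘ (outside ∷_)) τ ⟩
  0ℚ ∎
  where open ≡-Reasoning
∂∂≡0 {suc N} c (inside ∷ τ) = begin
  ∂ (∂ c) (inside ∷ τ)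
    ≡⟨ ∂-inside (∂ c) τ ⟩
  ⊖ ∂ (∂ c ∘ (inside ∷_)) τ
    ≡⟨ cong ⊖_ (trans (resp ∂-linear (∂-inside c) τ) (linear-neg ∂-linear (∂ (c ∘ (inside ∷_))) τ)) ⟩
  ⊖ (⊖ ∂ (∂ (c ∘ (inside ∷_))) τ)
    ≡⟨ neg-neg (∂ (∂ (c ∘ (inside ∷_))) τ) ⟩
  ∂ (∂ (c ∘ (inside ∷_))) τ
    ≡⟨ ∂∂≡0 (c ∘ (inside ∷_)) τ ⟩
  0ℚ ∎
  where open ≡-Reasoning

-- Some summand must be nonzero, and the cardinality records that its vertex is new. This controls
-- both the support and the degree of a boundary.
∂-support : ∀ (c : Chain N) τ → ∂ c τ ≢ 0ℚ → ∃ λ v → ∣ τ ∪ ⁅ v ⁆ ∣ ≡ suc ∣ τ ∣ × c (τ ∪ ⁅ v ⁆) ≢ 0ℚ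
∂-support {zero} c [] ne = contradiction refl ne
∂-support {suc N} c (outside ∷ τ) ne with c (inside ∷ τ ∪ ⊥) ℚ.≟ 0ℚ
... | no ne′ = zero , cong (suc ∘ ∣_∣) (∪-identityʳ τ) , ne′
... | yes e  =
  let v , s , ne″ = ∂-support (c ∘ (outside ∷_)) τ λ e′ → ne (trans (∂-outside c τ)
        (cong₂ _+ℚ_ (trans (cong (λ ρ → c (inside ∷ ρ)) (sym (∪-identityʳ τ))) e) e′))
  in suc v , s , ne″
∂-support {suc N} c (inside ∷ τ) ne =
  let v , s , ne′ = ∂-support (c ∘ (inside ∷_)) τ λ e → ne (trans (∂-inside c τ) (cong ⊖_ e))
  in suc v , cong suc s , ne′

-- The join with the vertex a, oriented so that a comes first.
cone : Fin N → Chain N → Chain N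
cone zero    c (outside ∷ σ) = 0ℚ
cone zero    c (inside  ∷ σ) = c (outside ∷ σ)
cone (suc a) c (outside ∷ σ) = cone a (c ∘ (outside ∷_)) σ
cone (suc a) c (inside  ∷ σ) = ⊖ cone a (c ∘ (inside ∷_)) σ

cone-linear : ∀ (a : Fin N) → Linear (cone a)
cone-linear zero    .resp e (outside ∷ σ) = refl
cone-linear zero    .resp e (inside  ∷ σ) = e (outside ∷ σ)
cone-linear (suc a) .resp e (outside ∷ σ) = cone-linear a .resp (λ ρ → e (outside ∷ ρ)) σ
cone-linear (suc a) .resp e (inside  ∷ σ) = cong ⊖_ (cone-linear a .resp (λ ρ → e (inside ∷ ρ)) σ)
cone-linear zero    .lin x r g (outside ∷ σ) = zero-lin r
cone-linear zero    .lin x r g (inside  ∷ σ) = refl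
cone-linear (suc a) .lin x r g (outside ∷ σ) = cone-linear a .lin (x ∘ (outside ∷_)) r (g ∘ (outside ∷_)) σ
cone-linear (suc a) .lin x r g (inside  ∷ σ) = trans
  (cong ⊖_ (cone-linear a .lin (x ∘ (inside ∷_)) r (g ∘ (inside ∷_)) σ)) (neg-lin (cone a (x ∘ (inside ∷_)) σ) r (cone a (g ∘ (inside ∷_)) σ))

cone-support : ∀ (a : Fin N) c σ → cone a c σ ≢ 0ℚ →
               ∃ λ ρ → σ ≡ ρ ∪ ⁅ a ⁆ × ∣ σ ∣ ≡ suc ∣ ρ ∣ × c ρ ≢ 0ℚ
cone-support zero    c (outside ∷ σ) ne = contradiction refl ne
cone-support zero    c (inside  ∷ σ) ne = outside ∷ σ , cong (inside ∷_) (sym (∪-identityʳ σ)) , refl , ne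
cone-support (suc a) c (outside ∷ σ) ne =
  let ρ , e , s , ne′ = cone-support a (c ∘ (outside ∷_)) σ ne
  in outside ∷ ρ , cong (outside ∷_) e , s , ne′
cone-support (suc a) c (inside ∷ σ) ne =
  let ρ , e , s , ne′ = cone-support a (c ∘ (inside ∷_)) σ (ne ∘ cong ⊖_)
  in inside ∷ ρ , cong (inside ∷_) e , cong suc s , ne′

-- The cone operator is a contracting homotopy of the full simplex. It holds for every chain since
-- `cone a` kills the simplices that already contain `a`. The induction is on the position of `a`.
cone-homotopy : ∀ (a : Fin N) c τ → ∂ (cone a c) τ +ℚ cone a (∂ c) τ ≡ c τ
cone-homotopy zero c (outside ∷ τ) = begin
  ∂ (cone zero c) (outside ∷ τ) +ℚ 0ℚ
    ≡⟨ ℚ.+-identityʳ _ ⟩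
  ∂ (cone zero c) (outside ∷ τ)
    ≡⟨ ∂-outside (cone zero c) τ ⟩
  c (outside ∷ τ) +ℚ ∂ 𝟎 τ
    ≡⟨ cong (c (outside ∷ τ) +ℚ_) (zer ∂-linear (λ _ → refl) τ) ⟩
  c (outside ∷ τ) +ℚ 0ℚ
    ≡⟨ ℚ.+-identityʳ _ ⟩
  c (outside ∷ τ) ∎
  where open ≡-Reasoning
cone-homotopy zero c (inside ∷ τ) = begin
  ∂ (cone zero c) (inside ∷ τ) +ℚ ∂ c (outside ∷ τ)
    ≡⟨ cong₂ _+ℚ_ (∂-inside (cone zero c) τ) (∂-outside c τ) ⟩
  ⊖ ∂ (c ∘ (outside ∷_)) τ +ℚ (c (inside ∷ τ) +ℚ ∂ (c ∘ (outside ∷_)) τ)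
    ≡⟨ neg-cancelʳ (∂ (c ∘ (outside ∷_)) τ) (c (inside ∷ τ)) ⟩
  c (inside ∷ τ) ∎
  where open ≡-Reasoning
cone-homotopy (suc a) c (outside ∷ τ) = begin
  ∂ (cone (suc a) c) (outside ∷ τ) +ℚ cone a (∂ c ∘ (outside ∷_)) τ
    ≡⟨ cong₂ _+ℚ_ (∂-outside (cone (suc a) c) τ)
         (trans (cone-linear a .resp (∂-outside c) τ) (linear-+ (cone-linear a) (c ∘ (inside ∷_)) (∂ (c ∘ (outside ∷_))) τ)) ⟩
  (⊖ cone a (c ∘ (inside ∷_)) τ +ℚ ∂ (cone a (c ∘ (outside ∷_))) τ)
    +ℚ (cone a (c ∘ (inside ∷_)) τ +ℚ cone a (∂ (c ∘ (outside ∷_))) τ)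
    ≡⟨ neg-cancelˡ (cone a (c ∘ (inside ∷_)) τ) (∂ (cone a (c ∘ (outside ∷_))) τ) (cone a (∂ (c ∘ (outside ∷_))) τ) ⟩
  ∂ (cone a (c ∘ (outside ∷_))) τ +ℚ cone a (∂ (c ∘ (outside ∷_))) τ
    ≡⟨ cone-homotopy a (c ∘ (outside ∷_)) τ ⟩
  c (outside ∷ τ) ∎
  where open ≡-Reasoning
cone-homotopy (suc a) c (inside ∷ τ) = begin
  ∂ (cone (suc a) c) (inside ∷ τ) +ℚ ⊖ cone a (∂ c ∘ (inside ∷_)) τ
    ≡⟨ cong₂ (λ x y → x +ℚ ⊖ y)
         (trans (∂-inside (cone (suc a) c) τ) (cong ⊖_ (linear-neg ∂-linear (cone a (c ∘ (inside ∷_))) τ)))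
         (trans (cone-linear a .resp (∂-inside c) τ) (linear-neg (cone-linear a) (∂ (c ∘ (inside ∷_))) τ)) ⟩
  ⊖ (⊖ ∂ (cone a (c ∘ (inside ∷_))) τ) +ℚ ⊖ (⊖ cone a (∂ (c ∘ (inside ∷_))) τ)
    ≡⟨ cong₂ _+ℚ_ (neg-neg (∂ (cone a (c ∘ (inside ∷_))) τ)) (neg-neg (cone a (∂ (c ∘ (inside ∷_))) τ)) ⟩
  ∂ (cone a (c ∘ (inside ∷_))) τ +ℚ cone a (∂ (c ∘ (inside ∷_))) τ
    ≡⟨ cone-homotopy a (c ∘ (inside ∷_)) τ ⟩
  c (inside ∷ τ) ∎
  where open ≡-Reasoning

-- Chains of a complex

infix 4 _≼_

_≼_ : SimplicialComplex N → SimplicialComplex N → Set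
K ≼ L = ∀ {σ} → Face K σ → Face L σ

chain-mono : ∀ (K L : SimplicialComplex N) → K ≼ L → ∀ {p c} → IsChain K p c → IsChain L p c
chain-mono K L K≼L h σ ne = let f , s = h σ ne in K≼L f , s

chain-resp : ∀ (K : SimplicialComplex N) {p x y} → x ≗ y → IsChain K p x → IsChain K p y
chain-resp K e h σ ne = h σ λ e′ → ne (trans (sym (e σ)) e′)

chain-- : ∀ (K : SimplicialComplex N) {p x y} → IsChain K p x → IsChain K p y → IsChain K p (λ σ → x σ -ℚ y σ)
chain-- K {x = x} {y} hx hy σ ne with x σ ℚ.≟ 0ℚ
... | no ne′ = hx σ ne′
... | yes e  = hy σ λ e′ → ne (cong₂ _-ℚ_ e e′)

chain-+ : ∀ (K : SimplicialComplex N) {p x y} → IsChain K p x → IsChain K p y → IsChain K p (λ σ → x σ +ℚ y σ)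
chain-+ K {x = x} {y} hx hy σ ne with x σ ℚ.≟ 0ℚ
... | no ne′ = hx σ ne′
... | yes e  = hy σ λ e′ → ne (cong₂ _+ℚ_ e e′)

chain-∂ : ∀ (K : SimplicialComplex N) {p b} → IsChain K (suc p) b → IsChain K p (∂ b)
chain-∂ K {b = b} h τ ne =
  let v , s , ne′ = ∂-support b τ ne
      f , s′      = h (τ ∪ ⁅ v ⁆) ne′
  in closed K (p⊆p∪q ⁅ v ⁆) f , ℕ.suc-injective (trans (sym s) s′)

chain-off : ∀ (K : SimplicialComplex N) {p c} → IsChain K p c → ∀ {σ} → ¬ Face K σ → c σ ≡ 0ℚ
chain-off K {c = c} h {σ} ¬f = decidable-stable (c σ ℚ.≟ 0ℚ) λ ne → ¬f (proj₁ (h σ ne))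

∂-sub-∂ : ∀ (x b : Chain N) → ∂ (λ σ → x σ -ℚ ∂ b σ) ≗ ∂ x
∂-sub-∂ x b τ = trans (linear-- ∂-linear x (∂ b) τ)
  (trans (cong (∂ x τ -ℚ_) (∂∂≡0 b τ)) (sub-zero (∂ x τ)))

acyclic-resp : ∀ (K L : SimplicialComplex N) → K ≼ L → L ≼ K → ∀ {r} → Acyclic K r → Acyclic L r
acyclic-resp K L K≼L L≼K A p p<r c (h , z) =
  let b , hb , e = A p p<r c (chain-mono L K L≼K h , z) in b , chain-mono K L K≼L hb , e

-- Collapses

-- Vanishing of the relative homology of the pair (`K`, `L`) in all degrees: chains are compared
-- only on simplices outside `L`.
RelativelyAcyclic : SimplicialComplex N → SimplicialComplex N → Set
RelativelyAcyclic K L = ∀ {p c} → IsChain K p c → (∀ τ → ¬ Face L τ → ∂ c τ ≡ 0ℚ) →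
  ∃ λ b → IsChain K (suc p) b × (∀ σ → ¬ Face L σ → ∂ b σ ≡ c σ)

module _ (K L : SimplicialComplex N) (L≼K : L ≼ K) (rel : RelativelyAcyclic K L) where

  push : ∀ {p c} → IsChain K p c → (∀ τ → ¬ Face L τ → ∂ c τ ≡ 0ℚ) →
         ∃ λ b → IsChain K (suc p) b × IsChain L p (λ σ → c σ -ℚ ∂ b σ)
  push {p} {c} h z = b , hb , λ σ ne → into-L σ ne , proj₂ (chain-- K h (chain-∂ K hb) σ ne)
    where
    b  = proj₁ (rel h z)
    hb = proj₁ (proj₂ (rel h z))
    into-L : ∀ σ → c σ -ℚ ∂ b σ ≢ 0ℚ → Face L σ
    into-L σ ne = decidable-stable (face? L σ) λ ¬f → ne
      (trans (cong (c σ -ℚ_) (proj₂ (proj₂ (rel h z)) σ ¬f)) (sub-self (c σ)))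

  -- A filling in `K` of a cycle of `L` is itself a relative cycle, so `push`, applied one degree
  -- higher, moves it into `L` without changing its boundary.
  acyclic-restrict : ∀ {r} → Acyclic K r → Acyclic L r
  acyclic-restrict A p p<r c (h , z) =
    let b , hb , e  = A p p<r c (chain-mono L K L≼K h , z)
        d , hd , he = push hb λ τ ¬f → trans (e τ) (chain-off L h ¬f)
    in (λ σ → b σ -ℚ ∂ d σ) , he , λ τ → trans (∂-sub-∂ b d τ) (e τ)

  -- A cycle of `K` is pushed into `L` and filled there; the chain used for the push completes the
  -- filling.
  acyclic-extend : ∀ {r} → Acyclic L r → Acyclic K r
  acyclic-extend A p p<r c (h , z) =
    let b , hb , hd = push h λ τ _ → z τ
        d , he , e  = A p p<r _ (hd , λ τ → trans (∂-sub-∂ c b τ) (z τ))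
    in (λ σ → b σ +ℚ d σ) , chain-+ K hb (chain-mono L K L≼K he) , λ τ →
       trans (linear-+ ∂-linear b d τ) (trans (cong (∂ b τ +ℚ_) (e τ)) (add-sub (∂ b τ) (c τ)))

restrict : ∀ {A : Set} → Dec A → ℚ → ℚ
restrict (yes _) x = x
restrict (no _)  x = 0ℚ

restrict-yes : ∀ {A : Set} (A? : Dec A) {x} → A → restrict A? x ≡ x
restrict-yes (yes _) _ = refl
restrict-yes (no ¬a) a = contradiction a ¬a

restrict-support : ∀ {A : Set} (A? : Dec A) {x} → restrict A? x ≢ 0ℚ → A × x ≢ 0ℚ
restrict-support (yes a) ne = a , ne
restrict-support (no _)  ne = contradiction refl ne

x∉p-x : ∀ (x : Fin N) p → x ∉ p - x
x∉p-x zero    (_ ∷ p) ()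
x∉p-x (suc x) (_ ∷ p) (there x∈) = x∉p-x x p x∈

p⊆p-x∪x : ∀ (x : Fin N) p → p ⊆ (p - x) ∪ ⁅ x ⁆
p⊆p-x∪x x p {y} y∈p with y Fin.≟ x
... | yes refl = q⊆p∪q (p - x) ⁅ x ⁆ (x∈⁅x⁆ x)
... | no y≢x   = p⊆p∪q ⁅ x ⁆ (x∈p∧x≢y⇒x∈p-y y∈p y≢x)

-- An acyclic matching σ ↔ σ △ {apex σ} of the simplices of K outside L.
record Matching (K L : SimplicialComplex N) : Set where
  field
    apex     : Subset N → Fin N
    add      : ∀ {σ} → Face K σ → ¬ Face L σ → Face K (σ ∪ ⁅ apex σ ⁆)
    remove   : ∀ {σ ρ} → Face K σ → ¬ Face L σ → σ ⊆ ρ ∪ ⁅ apex σ ⁆ → ¬ Face L ρ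
    constant : ∀ {σ ρ} → Face K ρ → ¬ Face L σ → σ ⊆ ρ → apex σ ≡ apex ρ

-- The filling `b` takes at each new simplex the value of the cone with that simplex's own apex. As
-- the apex is constant along inclusions outside `L`, near `τ` these values come from the single
-- operator `cone (apex τ)`, and `cone-homotopy` applies.
matching⇒relativelyAcyclic : ∀ (K L : SimplicialComplex N) → Matching K L → RelativelyAcyclic K L
matching⇒relativelyAcyclic {N} K L matching {p} {c} h z = b , b-chain , ∂b≡c
  where
  open Matching matching

  new? : ∀ σ → Dec (Face K σ × ¬ Face L σ)
  new? σ = face? K σ ×-dec ¬? (face? L σ)

  b : Chain N
  b σ = restrict (new? σ) (cone (apex σ) c σ)

  b-chain : IsChain K (suc p) b
  b-chain σ ne =
    let (f , _) , ne′      = restrict-support (new? σ) ne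
        ρ , _ , s , ne″ = cone-support (apex σ) c σ ne′
    in f , trans s (cong suc (proj₂ (h ρ ne″)))

  module _ {τ} (f : Face K τ) (¬f : ¬ Face L τ) where

    -- A nonzero value would come from some `ρ` in the support of `c` with `τ ∪ ⁅ v ⁆` equal to
    -- `ρ ∪ ⁅ apex τ ⁆`. The simplices `ρ` and `τ` share the face `τ - apex τ` outside `L`, hence
    -- have the same apex, and `add` would put `τ ∪ ⁅ v ⁆` into `K`.
    cone-off : ∀ {v} → ¬ Face K (τ ∪ ⁅ v ⁆) → cone (apex τ) c (τ ∪ ⁅ v ⁆) ≡ 0ℚ
    cone-off {v} ¬g = decidable-stable (cone (apex τ) c (τ ∪ ⁅ v ⁆) ℚ.≟ 0ℚ) λ ne →
      let ρ , e , _ , ne′ = cone-support (apex τ) c (τ ∪ ⁅ v ⁆) ne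
          g   = proj₁ (h ρ ne′)
          ¬g′ = remove f ¬f (subst (τ ⊆_) e (p⊆p∪q ⁅ v ⁆))
          ¬f′ = remove f ¬f (p⊆p-x∪x (apex τ) τ)
          τ-a⊆ρ : τ - apex τ ⊆ ρ
          τ-a⊆ρ = λ {x} x∈ → [ (λ x∈ρ → x∈ρ) , (λ x∈a → contradiction
            (subst (_∈ τ - apex τ) (x∈⁅y⁆⇒x≡y (apex τ) x∈a) x∈) (x∉p-x (apex τ) τ)) ]′
            (x∈p∪q⁻ ρ ⁅ apex τ ⁆ (subst (x ∈_) e (p⊆p∪q ⁅ v ⁆ (p─q⊆p τ ⁅ apex τ ⁆ x∈))))
          ea  = trans (sym (constant g ¬f′ τ-a⊆ρ)) (constant f ¬f′ (p─q⊆p τ ⁅ apex τ ⁆))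
      in ¬g (subst (Face K) (trans (cong (λ a → ρ ∪ ⁅ a ⁆) ea) (sym e)) (add g ¬g′))

    b≡cone : ∀ v → b (τ ∪ ⁅ v ⁆) ≡ cone (apex τ) c (τ ∪ ⁅ v ⁆)
    b≡cone v with face? K (τ ∪ ⁅ v ⁆)
    ... | no ¬g = sym (cone-off ¬g)
    ... | yes g with face? L (τ ∪ ⁅ v ⁆)
    ...   | yes g′ = contradiction (closed L (p⊆p∪q ⁅ v ⁆) g′) ¬f
    ...   | no _   = cong (λ a → cone a c (τ ∪ ⁅ v ⁆)) (sym (constant g ¬f (p⊆p∪q ⁅ v ⁆)))

    -- The cone only reads `∂ c` at a simplex from which `τ` arises by adding its apex; by `remove`
    -- that simplex is outside `L`, where `∂ c` vanishes.
    cone-∂c : cone (apex τ) (∂ c) τ ≡ 0ℚ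
    cone-∂c = decidable-stable (cone (apex τ) (∂ c) τ ℚ.≟ 0ℚ) λ ne →
      let ρ , e , _ , ne′ = cone-support (apex τ) (∂ c) τ ne in
      ne′ (z ρ (remove f ¬f (⊆-reflexive e)))

  ∂b≡c : ∀ τ → ¬ Face L τ → ∂ b τ ≡ c τ
  ∂b≡c τ ¬f with face? K τ
  ... | no ¬g = trans (chain-off K (chain-∂ K b-chain) ¬g) (sym (chain-off K h ¬g))
  ... | yes g = begin
    ∂ b τ
      ≡⟨ sum-cong-≗ {N} (λ v → cong (incidence v τ *ℚ_) (b≡cone g ¬f v)) ⟩
    ∂ (cone (apex τ) c) τ
      ≡⟨ ℚ.+-identityʳ (∂ (cone (apex τ) c) τ) ⟨
    ∂ (cone (apex τ) c) τ +ℚ 0ℚ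
      ≡⟨ cong (∂ (cone (apex τ) c) τ +ℚ_) (cone-∂c g ¬f) ⟨
    ∂ (cone (apex τ) c) τ +ℚ cone (apex τ) (∂ c) τ
      ≡⟨ cone-homotopy (apex τ) c τ ⟩
    c τ ∎
    where open ≡-Reasoning

cone-acyclic : ∀ (K : SimplicialComplex N) a → (∀ {σ} → Face K σ → Face K (σ ∪ ⁅ a ⁆)) → ∀ r → Acyclic K r
cone-acyclic K a add r p _ c (h , z) = cone a c , cone-chain , λ τ →
  trans (sym (trans (cong (∂ (cone a c) τ +ℚ_) (zer (cone-linear a) z τ)) (ℚ.+-identityʳ (∂ (cone a c) τ))))
    (cone-homotopy a c τ)
  where
  cone-chain : IsChain K (suc p) (cone a c)
  cone-chain σ ne =
    let ρ , e , s , ne′ = cone-support a c σ ne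
        f , s′          = h ρ ne′
    in subst (Face K) (sym e) (add f) , trans s (cong suc s′)

-- Mayer–Vietoris

infixr 6 _∪ᶜ_
infixr 7 _∩ᶜ_

_∪ᶜ_ : SimplicialComplex N → SimplicialComplex N → SimplicialComplex N
K ∪ᶜ L = record
  { Face   = λ σ → Face K σ ⊎ Face L σ
  ; face?  = λ σ → face? K σ ⊎-dec face? L σ
  ; ⊥-face = inj₁ (⊥-face K)
  ; closed = λ τ⊆σ → Sum.map (closed K τ⊆σ) (closed L τ⊆σ)
  }

_∩ᶜ_ : SimplicialComplex N → SimplicialComplex N → SimplicialComplex N
K ∩ᶜ L = record
  { Face   = λ σ → Face K σ × Face L σ
  ; face?  = λ σ → face? K σ ×-dec face? L σ
  ; ⊥-face = ⊥-face K , ⊥-face L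
  ; closed = λ τ⊆σ (f , g) → closed K τ⊆σ f , closed L τ⊆σ g
  }

-- Fill `z` by `a` in `K` and by `b` in `L`. The difference `a - b` is a cycle of the union, one
-- degree higher, so it bounds some `c`. Cutting `c` into its part `cK` in `K` and a rest in `L`
-- corrects `a` and `b` to one and the same filling, which lies in both complexes.
mayer-vietoris : ∀ (K L : SimplicialComplex N) {r} → Acyclic K r → Acyclic L r → Acyclic (K ∪ᶜ L) (suc r) →
                 Acyclic (K ∩ᶜ L) r
mayer-vietoris {N} K L {r} AK AL AU p p<r z (h , ∂z≡0) = bound
  where
  bound : IsBoundary (K ∩ᶜ L) p z
  bound with AK p p<r z (chain-mono (K ∩ᶜ L) K proj₁ h , ∂z≡0)
           | AL p p<r z (chain-mono (K ∩ᶜ L) L proj₂ h , ∂z≡0)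
  ... | a , ha , ea | b , hb , eb = y , y-chain , λ τ → trans (∂-sub-∂ a cK τ) (ea τ)
    where
    filling = AU (suc p) (s≤s p<r) (λ σ → a σ -ℚ b σ)
      ( chain-- (K ∪ᶜ L) (chain-mono K (K ∪ᶜ L) inj₁ ha) (chain-mono L (K ∪ᶜ L) inj₂ hb)
      , λ τ → trans (linear-- ∂-linear a b τ) (trans (cong₂ _-ℚ_ (ea τ) (eb τ)) (sub-self (z τ))) )
    c = proj₁ filling
    hc = proj₁ (proj₂ filling)
    ec = proj₂ (proj₂ filling)
    cK : Chain N
    cK σ = restrict (face? K σ) (c σ)
    cK-chain : IsChain K (suc (suc p)) cK
    cK-chain σ ne = let f , ne′ = restrict-support (face? K σ) ne in f , proj₂ (hc σ ne′)
    rest-chain : IsChain L (suc (suc p)) (λ σ → cK σ -ℚ c σ)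
    rest-chain σ ne with face? K σ
    ... | yes _ = contradiction (sub-self (c σ)) ne
    ... | no ¬f = let f⊎g , s = hc σ (λ e → ne (cong (0ℚ -ℚ_) e)) in
                  [ (λ f → contradiction f ¬f) , (λ g → g) ]′ f⊎g , s
    y : Chain N
    y σ = a σ -ℚ ∂ cK σ
    y-alt : ∀ σ → b σ -ℚ ∂ (λ ρ → cK ρ -ℚ c ρ) σ ≡ y σ
    y-alt σ = trans (cong (b σ -ℚ_) (trans (linear-- ∂-linear cK c σ) (cong (∂ cK σ -ℚ_) (ec σ))))
      (sym (sub-transfer (a σ) (b σ) (∂ cK σ)))
    y-chain : IsChain (K ∩ᶜ L) (suc p) y
    y-chain σ ne =
      let f , s = chain-- K ha (chain-∂ K cK-chain) σ ne
          g , _ = chain-resp L y-alt (chain-- L hb (chain-∂ L rest-chain)) σ ne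
      in (f , g) , s

-- Threshold complexes

∈-tabulate⁺ : ∀ {n} {P : Fin n → Set} (P? : ∀ i → Dec (P i)) {i} → P i → i ∈ tabulate (λ i → does (P? i))
∈-tabulate⁺ P? {i} Pi = Vec.lookup⇒[]= i _ (trans (Vec.lookup∘tabulate _ i) (dec-true (P? i) Pi))

∈-tabulate⁻ : ∀ {n} {P : Fin n → Set} (P? : ∀ i → Dec (P i)) {i} → i ∈ tabulate (λ i → does (P? i)) → P i
∈-tabulate⁻ P? {i} i∈ = decidable-stable (P? i) λ ¬Pi → contradiction
  (trans (sym (Vec.[]=⇒lookup i∈)) (trans (Vec.lookup∘tabulate _ i) (dec-false (P? i) ¬Pi))) λ ()

0<∣p∣⇒nonempty : ∀ {n} {p : Subset n} → 0 < ∣ p ∣ → Nonempty p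
0<∣p∣⇒nonempty {n} {p} 0<∣p∣ = decidable-stable (nonempty? p) λ empty →
  ℕ.<⇒≢ 0<∣p∣ (sym (trans (cong ∣_∣ (Empty-unique empty)) (∣⊥∣≡0 n)))

nonempty⇒0<∣p∣ : ∀ {n} {p : Subset n} → Nonempty p → 0 < ∣ p ∣
nonempty⇒0<∣p∣ {p = p} (x , x∈p) = subst (_≤ ∣ p ∣) (∣⁅x⁆∣≡1 x)
  (p⊆q⇒∣p∣≤∣q∣ λ y∈ → subst (_∈ p) (sym (x∈⁅y⁆⇒x≡y x y∈)) x∈p)

-- The predicate can fail even for the empty simplex, as for a union over no index or a threshold
-- above the number of complexes.
adjoin-⊥ : (P : Subset N → Set) → (∀ σ → Dec (P σ)) → (∀ {σ τ} → τ ⊆ σ → P σ → P τ) → SimplicialComplex N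
adjoin-⊥ P P? P-closed = record
  { Face   = λ σ → σ ≡ ⊥ ⊎ P σ
  ; face?  = λ σ → Vec.≡-dec Bool._≟_ σ ⊥ ⊎-dec P? σ
  ; ⊥-face = inj₁ refl
  ; closed = λ { τ⊆σ (inj₁ refl) → inj₁ (⊆-antisym τ⊆σ ⊥⊆) ; τ⊆σ (inj₂ Pσ) → inj₂ (P-closed τ⊆σ Pσ) }
  }

face-⊥ : ∀ (K : SimplicialComplex N) {σ} → σ ≡ ⊥ → Face K σ
face-⊥ K refl = ⊥-face K

union : ∀ {n} → (Fin n → SimplicialComplex N) → Subset n → SimplicialComplex N
union X I = adjoin-⊥ (λ σ → ∃ λ i → i ∈ I × Face (X i) σ)
  (λ σ → Fin.any? λ i → (i ∈? I) ×-dec face? (X i) σ)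
  (λ τ⊆σ (i , i∈I , f) → i , i∈I , closed (X i) τ⊆σ f)

members : ∀ {n} → (Fin n → SimplicialComplex N) → Subset N → Subset n
members X σ = tabulate (λ i → does (face? (X i) σ))

members-mono : ∀ {n} (X Y : Fin n → SimplicialComplex N) {σ τ} →
               (∀ i → Face (X i) σ → Face (Y i) τ) → ∣ members X σ ∣ ≤ ∣ members Y τ ∣
members-mono X Y {σ} {τ} h = p⊆q⇒∣p∣≤∣q∣ λ {i} i∈ →
  ∈-tabulate⁺ (λ i → face? (Y i) τ) (h i (∈-tabulate⁻ (λ i → face? (X i) σ) i∈))

threshold : ∀ {n} → ℕ → (Fin n → SimplicialComplex N) → SimplicialComplex N
threshold k X = adjoin-⊥ (λ σ → k ≤ ∣ members X σ ∣) (λ σ → k ℕ.≤? ∣ members X σ ∣)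
  (λ τ⊆σ k≤ → ℕ.≤-trans k≤ (members-mono X X λ i → closed (X i) τ⊆σ))

module _ {n} (X : Fin (suc n) → SimplicialComplex N) where

  private
    X₀ : SimplicialComplex N
    X₀ = X zero

    X₊ Y : Fin n → SimplicialComplex N
    X₊ i = X (suc i)
    Y  i = X₊ i ∪ᶜ X₀

    members-Y : ∀ {σ} → Face X₀ σ → n ≤ ∣ members Y σ ∣
    members-Y {σ} f = subst (_≤ ∣ members Y σ ∣) (∣⊤∣≡n n)
      (p⊆q⇒∣p∣≤∣q∣ {p = ⊤} λ _ → ∈-tabulate⁺ (λ i → face? (Y i) σ) (inj₂ f))

    -- Outside `X₀`, a simplex lies in `Y i` only if it lies in `X₊ i`; inside `X₀` it lies in every
    -- `Y i`, by `members-Y`.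
    split-Y : ∀ {k σ} → k ≤ ∣ members Y σ ∣ → Face X₀ σ ⊎ k ≤ ∣ members X₊ σ ∣
    split-Y {k} {σ} q = split (face? X₀ σ)
      where
      split : Dec (Face X₀ σ) → Face X₀ σ ⊎ k ≤ ∣ members X₊ σ ∣
      split (yes f) = inj₁ f
      split (no ¬f) = inj₂ (ℕ.≤-trans q (members-mono Y X₊ λ i → [ (λ g → g) , (λ f → contradiction f ¬f) ]′))

  -- Both unions have the same simplices: an index in `I` is needed to carry those of `X zero`.
  union-merge : ∀ {I r} → Nonempty I → Acyclic (union X (inside ∷ I)) r → Acyclic (union Y I) r
  union-merge {I} (j , j∈I) = acyclic-resp (union X (inside ∷ I)) (union Y I)
    (λ { (inj₁ e) → inj₁ e
       ; (inj₂ (zero , here , f)) → inj₂ (j , j∈I , inj₂ f)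
       ; (inj₂ (suc i , there i∈ , f)) → inj₂ (i , i∈ , inj₁ f) })
    (λ { (inj₁ e) → inj₁ e
       ; (inj₂ (i , i∈ , inj₁ f)) → inj₂ (suc i , there i∈ , f)
       ; (inj₂ (i , i∈ , inj₂ f)) → inj₂ (zero , here , f) })

  union-tail : ∀ {I r} → Acyclic (union X (outside ∷ I)) r → Acyclic (union X₊ I) r
  union-tail {I} = acyclic-resp (union X (outside ∷ I)) (union X₊ I)
    (λ { (inj₁ e) → inj₁ e
       ; (inj₂ (zero , () , f))
       ; (inj₂ (suc i , there i∈ , f)) → inj₂ (i , i∈ , f) })
    (λ { (inj₁ e) → inj₁ e
       ; (inj₂ (i , i∈ , f)) → inj₂ (suc i , there i∈ , f) })

  -- Lying in at least t + 1 of the X i means lying in at least t of those with i > 0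
  -- and, moreover, lying in X zero or in at least t + 1 of those with i > 0.
  threshold-step : ∀ {k r} → suc k ≤ n →
    Acyclic (threshold (suc k) X₊) r → Acyclic (X₀ ∪ᶜ threshold (suc (suc k)) X₊) r →
    Acyclic (threshold (suc k) Y) (suc r) → Acyclic (threshold (suc (suc k)) X) r
  threshold-step {k} {r} 1+k≤n A-acyclic B-acyclic Y-acyclic =
    acyclic-resp (A ∩ᶜ B) (threshold (suc (suc k)) X) ∩-into into-∩
      -- The union of the two terms is the threshold complex of `Y`: simplices of `X₀` lie in all
      -- `n` of the `Y i`, which suffices as `suc k ≤ n`, and the other simplices of `B` already lie
      -- in `A`.
      (mayer-vietoris A B A-acyclic B-acyclic (acyclic-resp (threshold (suc k) Y) (A ∪ᶜ B) into-∪ ∪-into Y-acyclic))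
    where
    A = threshold (suc k) X₊
    B = X₀ ∪ᶜ threshold (suc (suc k)) X₊

    ∩-into : (A ∩ᶜ B) ≼ threshold (suc (suc k)) X
    ∩-into (inj₁ e , _)               = inj₁ e
    ∩-into (inj₂ _ , inj₂ (inj₁ e))   = inj₁ e
    ∩-into {σ} (inj₂ _ , inj₂ (inj₂ q)) = inj₂ (ℕ.≤-trans q (∣p∣≤∣x∷p∣ (does (face? X₀ σ)) (members X₊ σ)))
    ∩-into {σ} (inj₂ q , inj₁ f)        = inj₂ (lemma (face? X₀ σ))
      where
      lemma : (d : Dec (Face X₀ σ)) → suc (suc k) ≤ ∣ does d ∷ members X₊ σ ∣
      lemma (yes _) = s≤s q
      lemma (no ¬f) = contradiction f ¬f

    into-∩ : threshold (suc (suc k)) X ≼ (A ∩ᶜ B)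
    into-∩ (inj₁ e) = inj₁ e , inj₁ (face-⊥ X₀ e)
    into-∩ {σ} (inj₂ q) = lemma (face? X₀ σ) q
      where
      lemma : (d : Dec (Face X₀ σ)) → suc (suc k) ≤ ∣ does d ∷ members X₊ σ ∣ → Face (A ∩ᶜ B) σ
      lemma (yes f) (s≤s q) = inj₂ q , inj₁ f
      lemma (no _)  q       = inj₂ (ℕ.≤-trans (ℕ.n≤1+n _) q) , inj₂ (inj₂ q)

    into-∪ : threshold (suc k) Y ≼ (A ∪ᶜ B)
    into-∪ (inj₁ e) = inj₁ (inj₁ e)
    into-∪ (inj₂ q) = [ (λ f → inj₂ (inj₁ f)) , (λ q → inj₁ (inj₂ q)) ]′ (split-Y q)

    ∪-into : (A ∪ᶜ B) ≼ threshold (suc k) Y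
    ∪-into (inj₁ (inj₁ e))        = inj₁ e
    ∪-into (inj₁ (inj₂ q))        = inj₂ (ℕ.≤-trans q (members-mono X₊ Y λ _ → inj₁))
    ∪-into (inj₂ (inj₁ f))        = inj₂ (ℕ.≤-trans 1+k≤n (members-Y f))
    ∪-into (inj₂ (inj₂ (inj₁ e))) = inj₁ e
    ∪-into (inj₂ (inj₂ (inj₂ q))) = inj₂ (ℕ.≤-trans (ℕ.n≤1+n _) (ℕ.≤-trans q (members-mono X₊ Y λ _ → inj₁)))

  -- Only `n` complexes remain in `X₊`, too few for the threshold `suc k`, so nothing but `X zero`
  -- is left.
  threshold-all : ∀ {k r} → n ≤ k → Acyclic (union X ⁅ zero ⁆) r → Acyclic (X₀ ∪ᶜ threshold (suc k) X₊) r
  threshold-all {k} n≤k = acyclic-resp (union X ⁅ zero ⁆) (X₀ ∪ᶜ threshold (suc k) X₊)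
    (λ { (inj₁ e) → inj₂ (inj₁ e)
       ; (inj₂ (zero , _ , f)) → inj₁ f
       ; (inj₂ (suc i , there i∈ , f)) → contradiction i∈ ∉⊥ })
    (λ { (inj₁ f) → inj₂ (zero , here , f)
       ; (inj₂ (inj₁ e)) → inj₁ e
       ; {σ} (inj₂ (inj₂ q)) → contradiction (ℕ.≤-trans q (ℕ.≤-trans (∣p∣≤n (members X₊ σ)) n≤k)) (ℕ.<-irrefl refl) })

  threshold-merge : ∀ {k r} → k ≤ n → Acyclic (threshold k Y) r → Acyclic (X₀ ∪ᶜ threshold k X₊) r
  threshold-merge {k} k≤n = acyclic-resp (threshold k Y) (X₀ ∪ᶜ threshold k X₊) to from
    where
    to : threshold k Y ≼ (X₀ ∪ᶜ threshold k X₊)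
    to (inj₁ e) = inj₂ (inj₁ e)
    to (inj₂ q) = Sum.map₂ inj₂ (split-Y q)
    from : (X₀ ∪ᶜ threshold k X₊) ≼ threshold k Y
    from (inj₁ f)        = inj₂ (ℕ.≤-trans k≤n (members-Y f))
    from (inj₂ (inj₁ e)) = inj₁ e
    from (inj₂ (inj₂ q)) = inj₂ (ℕ.≤-trans q (members-mono X₊ Y λ _ → inj₁))

threshold-one : ∀ {n} (X : Fin n → SimplicialComplex N) {r} → Acyclic (union X ⊤) r → Acyclic (threshold 1 X) r
threshold-one X = acyclic-resp (union X ⊤) (threshold 1 X)
  (λ { (inj₁ e) → inj₁ e
     ; {σ} (inj₂ (i , _ , f)) → inj₂ (nonempty⇒0<∣p∣ (i , ∈-tabulate⁺ (λ i → face? (X i) σ) f)) })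
  (λ { (inj₁ e) → inj₁ e
     ; {σ} (inj₂ q) → let i , i∈ = 0<∣p∣⇒nonempty q in inj₂ (i , ∈⊤ , ∈-tabulate⁻ (λ i → face? (X i) σ) i∈) })

-- Here `d` counts the complexes that a simplex may miss. The induction follows `threshold-step`;
-- each recursive call has one complex fewer.
threshold-acyclic : ∀ {n} (X : Fin n → SimplicialComplex N) k d m → suc k + d ≡ n →
  (∀ I → Nonempty I → d ≤ ∣ I ∣ → Acyclic (union X I) ((∣ I ∣ ∸ d) + m)) →
  Acyclic (threshold (suc k) X) (suc m)
-- For threshold one the only index set used is `⊤`, of size `suc d`, whose bound is `1 + m`.
threshold-acyclic X zero d m refl hyp = threshold-one X
  (subst (λ s → Acyclic (union X ⊤) (s + m)) (trans (cong (_∸ d) (∣⊤∣≡n (suc d))) (ℕ.m+n∸n≡m 1 d))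
    (hyp ⊤ (zero , here) (subst (d ≤_) (sym (∣⊤∣≡n (suc d))) (ℕ.n≤1+n d))))
threshold-acyclic {n = suc n} X (suc k) d m eq hyp = threshold-step X (ℕ.m+n≤o⇒m≤o (suc k) (ℕ.≤-reflexive eq′))
  (threshold-acyclic (X ∘ suc) k d m eq′ λ I (i , i∈I) d≤ → union-tail X (hyp (outside ∷ I) (suc i , there i∈I) d≤))
  (second d eq hyp)
  -- Each union of the `Y i` involves one more of the original complexes, namely `X zero`. This
  -- raises the bound by one and supplies the extra degree that Mayer-Vietoris asks of the union.
  (threshold-acyclic Y k d (suc m) eq′ λ I ne d≤ → union-merge X ne
    (subst (Acyclic (union X (inside ∷ I)))
      (trans (cong (_+ m) (ℕ.+-∸-assoc 1 d≤)) (sym (ℕ.+-suc (∣ I ∣ ∸ d) m)))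
      (hyp (inside ∷ I) (zero , here) (ℕ.m≤n⇒m≤1+n d≤))))
  where
  Y : Fin n → SimplicialComplex _
  Y i = X (suc i) ∪ᶜ X zero
  eq′ : suc k + d ≡ n
  eq′ = ℕ.suc-injective eq
  second : ∀ d → suc (suc k) + d ≡ suc n →
    (∀ I → Nonempty I → d ≤ ∣ I ∣ → Acyclic (union X I) ((∣ I ∣ ∸ d) + m)) →
    Acyclic (X zero ∪ᶜ threshold (suc (suc k)) (X ∘ suc)) (suc m)
  -- For `d = 0` the second term is `X zero` alone, and the hypothesis for the singleton gives
  -- exactly `1 + m`.
  second zero eq hyp = threshold-all X
    (ℕ.≤-reflexive (sym (trans (sym (ℕ.+-identityʳ (suc k))) (ℕ.suc-injective eq))))
    (subst (λ s → Acyclic (union X ⁅ zero ⁆) (s + m)) (∣⁅x⁆∣≡1 {suc n} zero) (hyp ⁅ zero ⁆ (zero , here) z≤n))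
  -- Here the additional complex `X zero` in each union compensates for lowering `d`, and `m` stays.
  second (suc d) eq hyp = threshold-merge X (ℕ.m+n≤o⇒m≤o (suc (suc k)) (ℕ.≤-reflexive eq″))
    (threshold-acyclic Y (suc k) d m eq″ λ I ne d≤ → union-merge X ne (hyp (inside ∷ I) (zero , here) (s≤s d≤)))
    where
    eq″ : suc (suc k) + d ≡ n
    eq″ = ℕ.suc-injective (trans (cong suc (sym (ℕ.+-suc (suc k) d))) eq)

-- Reindexing the vertices

-- An inclusion of vertex sets, given by its action on subsets. `∂-embed` restricts the support to
-- the image because cofaces through other vertices would contribute to the left-hand side only.
record Embedding (N M : ℕ) : Set where
  field
    embed         : Subset N → Subset M
    retract       : Subset M → Subset N
    retract-embed : ∀ τ → retract (embed τ) ≡ τ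
    embed-size    : ∀ τ → ∣ embed τ ∣ ≡ ∣ τ ∣
    ∂-embed       : ∀ c → (∀ σ → c σ ≢ 0ℚ → embed (retract σ) ≡ σ) → ∀ τ → ∂ c (embed τ) ≡ ∂ (c ∘ embed) τ

module _ (E : Embedding N M) where

  open Embedding E

  module _ (L : SimplicialComplex N) (K : SimplicialComplex M)
    (image : ∀ {σ} → Face K σ → embed (retract σ) ≡ σ)
    (L⇒K : ∀ {τ} → Face L τ → Face K (embed τ)) (K⇒L : ∀ {τ} → Face K (embed τ) → Face L τ) where

    private
      image? : ∀ σ → Dec (embed (retract σ) ≡ σ)
      image? σ = Vec.≡-dec Bool._≟_ (embed (retract σ)) σ

      extend : Chain N → Chain M
      extend c σ = restrict (image? σ) (c (retract σ))

      extend-embed : ∀ c τ → extend c (embed τ) ≡ c τ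
      extend-embed c τ = trans (restrict-yes (image? (embed τ)) (cong embed (retract-embed τ))) (cong c (retract-embed τ))

      extend-chain : ∀ {p c} → IsChain L p c → IsChain K p (extend c)
      extend-chain h σ ne =
        let e , ne′ = restrict-support (image? σ) ne
            f , s   = h (retract σ) ne′
        in subst (Face K) e (L⇒K f) , trans (trans (cong ∣_∣ (sym e)) (embed-size (retract σ))) s

      embed-chain : ∀ {p c} → IsChain K p c → IsChain L p (c ∘ embed)
      embed-chain h τ ne = let f , s = h (embed τ) ne in K⇒L f , trans (sym (embed-size τ)) s

      ∂-chain : ∀ {p c} → IsChain K p c → ∀ τ → ∂ c (embed τ) ≡ ∂ (c ∘ embed) τ
      ∂-chain {c = c} h = ∂-embed c λ σ ne → image (proj₁ (h σ ne))

      ∂-extend : ∀ {p c} → IsChain L p c → ∀ τ → ∂ (extend c) (embed τ) ≡ ∂ c τ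
      ∂-extend {c = c} h τ = trans (∂-chain (extend-chain h) τ) (resp ∂-linear (extend-embed c) τ)

    acyclic-embed : ∀ {r} → Acyclic L r → Acyclic K r
    acyclic-embed A p p<r z (h , ∂z≡0) =
      let b , hb , e = A p p<r (z ∘ embed) (embed-chain h , λ τ → trans (sym (∂-chain h τ)) (∂z≡0 (embed τ)))
          agree : ∀ σ → Dec (Face K σ) → ∂ (extend b) σ ≡ z σ
          agree σ = λ
            { (no ¬f) → trans (chain-off K (chain-∂ K (extend-chain hb)) ¬f) (sym (chain-off K h ¬f))
            ; (yes f) → subst (λ σ → ∂ (extend b) σ ≡ z σ) (image f) (trans (∂-extend hb (retract σ)) (e (retract σ))) }
      in extend b , extend-chain hb , λ σ → agree σ (face? K σ)

    acyclic-unembed : ∀ {r} → Acyclic K r → Acyclic L r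
    acyclic-unembed A p p<r z (h , ∂z≡0) =
      let b , hb , e = A p p<r (extend z) (extend-chain h , λ σ → ∂-extend-zero σ (image? σ))
      in b ∘ embed , embed-chain hb , λ τ → trans (sym (∂-chain hb τ)) (trans (e (embed τ)) (extend-embed z τ))
      where
      ∂-extend-zero : ∀ σ → Dec (embed (retract σ) ≡ σ) → ∂ (extend z) σ ≡ 0ℚ
      ∂-extend-zero σ (yes e) = subst (λ σ → ∂ (extend z) σ ≡ 0ℚ) e (trans (∂-extend h (retract σ)) (∂z≡0 (retract σ)))
      -- A nonzero coefficient would make `σ` a face of a simplex of `K`, hence a member of the
      -- image.
      ∂-extend-zero σ (no ¬e) = decidable-stable (∂ (extend z) σ ℚ.≟ 0ℚ) λ ne →
        let v , s , ne′ = ∂-support (extend z) σ ne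
            g , _       = extend-chain h (σ ∪ ⁅ v ⁆) ne′
        in ¬e (image (closed K (p⊆p∪q ⁅ v ⁆) g))

take-++ : ∀ (τ : Subset N) (S : Subset M) → take N (τ ++ S) ≡ τ
take-++ []      S = refl
take-++ (b ∷ τ) S = cong (b ∷_) (take-++ τ S)

drop-++ : ∀ (τ : Subset N) (S : Subset M) → drop N (τ ++ S) ≡ S
drop-++ []      S = refl
drop-++ (b ∷ τ) S = drop-++ τ S

take-mono : ∀ N {σ ρ : Subset (N + M)} → σ ⊆ ρ → take N σ ⊆ take N ρ
take-mono (suc N) {_ ∷ _} {_ ∷ _} σ⊆ρ here with here ← σ⊆ρ here = here
take-mono (suc N) {_ ∷ _} {_ ∷ _} σ⊆ρ (there v∈) = there (take-mono N (drop-∷-⊆ σ⊆ρ) v∈)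

drop-mono : ∀ N {σ ρ : Subset (N + M)} → σ ⊆ ρ → drop N σ ⊆ drop N ρ
drop-mono zero    σ⊆ρ = σ⊆ρ
drop-mono (suc N) {_ ∷ _} {_ ∷ _} σ⊆ρ = drop-mono N (drop-∷-⊆ σ⊆ρ)

take-⊥ : ∀ N → take N {M} ⊥ ≡ ⊥
take-⊥ zero    = refl
take-⊥ (suc N) = cong (outside ∷_) (take-⊥ N)

drop-⊥ : ∀ N → drop N {M} ⊥ ≡ ⊥
drop-⊥ zero    = refl
drop-⊥ (suc N) = drop-⊥ N

take-∪-↑ˡ : ∀ (σ : Subset (N + M)) v → take N (σ ∪ ⁅ v ↑ˡ M ⁆) ≡ take N σ ∪ ⁅ v ⁆
take-∪-↑ˡ {N} {M} σ v = trans (Vec.take-zipWith _ σ ⁅ v ↑ˡ M ⁆) (cong (take N σ ∪_) (take-⁅⁆ v))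
  where
  take-⁅⁆ : ∀ {N} (v : Fin N) → take N ⁅ v ↑ˡ M ⁆ ≡ ⁅ v ⁆
  take-⁅⁆ {suc N} zero    = cong (inside ∷_) (take-⊥ N)
  take-⁅⁆ {suc N} (suc v) = cong (outside ∷_) (take-⁅⁆ v)

drop-∪-↑ˡ : ∀ (σ : Subset (N + M)) v → drop N (σ ∪ ⁅ v ↑ˡ M ⁆) ≡ drop N σ
drop-∪-↑ˡ {N} {M} σ v = trans (Vec.drop-zipWith _ σ ⁅ v ↑ˡ M ⁆) (trans (cong (drop N σ ∪_) (drop-⁅⁆ v)) (∪-identityʳ (drop N σ)))
  where
  drop-⁅⁆ : ∀ {N} (v : Fin N) → drop N ⁅ v ↑ˡ M ⁆ ≡ ⊥
  drop-⁅⁆ {suc N} zero    = drop-⊥ N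
  drop-⁅⁆ {suc N} (suc v) = drop-⁅⁆ v

take-∪-↑ʳ : ∀ (σ : Subset (N + M)) x → take N (σ ∪ ⁅ N ↑ʳ x ⁆) ≡ take N σ
take-∪-↑ʳ {N} {M} σ x = trans (Vec.take-zipWith _ σ ⁅ N ↑ʳ x ⁆) (trans (cong (take N σ ∪_) (take-⁅⁆ N)) (∪-identityʳ (take N σ)))
  where
  take-⁅⁆ : ∀ N → take N ⁅ N ↑ʳ x ⁆ ≡ ⊥
  take-⁅⁆ zero    = refl
  take-⁅⁆ (suc N) = cong (outside ∷_) (take-⁅⁆ N)

drop-∪-↑ʳ : ∀ (σ : Subset (N + M)) x → drop N (σ ∪ ⁅ N ↑ʳ x ⁆) ≡ drop N σ ∪ ⁅ x ⁆
drop-∪-↑ʳ {N} {M} σ x = trans (Vec.drop-zipWith _ σ ⁅ N ↑ʳ x ⁆) (cong (drop N σ ∪_) (drop-⁅⁆ N))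
  where
  drop-⁅⁆ : ∀ N → drop N ⁅ N ↑ʳ x ⁆ ≡ ⁅ x ⁆
  drop-⁅⁆ zero    = refl
  drop-⁅⁆ (suc N) = drop-⁅⁆ N

left-embedding : ∀ N M → Embedding N (N + M)
left-embedding N M = record
  { embed         = _++ ⊥
  ; retract       = take N
  ; retract-embed = λ τ → take-++ τ ⊥
  ; embed-size    = size {N}
  ; ∂-embed       = ∂-++
  }
  where
  size : ∀ {N} (τ : Subset N) → ∣ τ ++ ⊥ {M} ∣ ≡ ∣ τ ∣
  size []            = ∣⊥∣≡0 M
  size (inside ∷ τ)  = cong suc (size τ)
  size (outside ∷ τ) = size τ
  ∂-++ : ∀ {N} (c : Chain (N + M)) → (∀ σ → c σ ≢ 0ℚ → take N σ ++ ⊥ ≡ σ) →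
         ∀ (τ : Subset N) → ∂ c (τ ++ ⊥) ≡ ∂ (c ∘ (_++ ⊥)) τ
  -- Only vertices outside the image remain; a coface through one of them is nonempty, so it is off
  -- the support.
  ∂-++ {zero} c supp [] = decidable-stable (∂ c ⊥ ℚ.≟ 0ℚ) λ ne →
    let v , s , ne′ = ∂-support c ⊥ ne in
    ℕ.1+n≢n (trans (sym s) (cong ∣_∣ (sym (supp (⊥ ∪ ⁅ v ⁆) ne′))))
  ∂-++ {suc N} c supp (outside ∷ τ) = trans (∂-outside c (τ ++ ⊥)) (trans
    (cong (c (inside ∷ τ ++ ⊥) +ℚ_)
      (∂-++ (c ∘ (outside ∷_)) (λ σ ne → Vec.∷-injectiveʳ (supp (outside ∷ σ) ne)) τ))
    (sym (∂-outside (c ∘ (_++ ⊥)) τ)))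
  ∂-++ {suc N} c supp (inside ∷ τ) = trans (∂-inside c (τ ++ ⊥)) (trans
    (cong ⊖_ (∂-++ (c ∘ (inside ∷_)) (λ σ ne → Vec.∷-injectiveʳ (supp (inside ∷ σ) ne)) τ))
    (sym (∂-inside (c ∘ (_++ ⊥)) τ)))

right-embedding : ∀ N M → Embedding M (N + M)
right-embedding N M = record
  { embed         = ⊥ {N} ++_
  ; retract       = drop N
  ; retract-embed = drop-++ (⊥ {N})
  ; embed-size    = size N
  ; ∂-embed       = ∂-++ N
  }
  where
  size : ∀ N (S : Subset M) → ∣ ⊥ {N} ++ S ∣ ≡ ∣ S ∣
  size zero    S = refl
  size (suc N) S = size N S
  ∂-++ : ∀ N (c : Chain (N + M)) → (∀ σ → c σ ≢ 0ℚ → ⊥ {N} ++ drop N σ ≡ σ) →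
         ∀ S → ∂ c (⊥ {N} ++ S) ≡ ∂ (c ∘ (⊥ {N} ++_)) S
  ∂-++ zero    c supp S = refl
  ∂-++ (suc N) c supp S = trans (∂-outside c (⊥ {N} ++ S)) (trans
    (cong (_+ℚ ∂ (c ∘ (outside ∷_)) (⊥ {N} ++ S)) head-zero)
    (trans (ℚ.+-identityˡ (∂ (c ∘ (outside ∷_)) (⊥ {N} ++ S)))
      (∂-++ N (c ∘ (outside ∷_)) (λ σ ne → Vec.∷-injectiveʳ (supp (outside ∷ σ) ne)) S)))
    where
    -- The simplex contains a vertex of the first block, so it is not in the image.
    head-zero : c (inside ∷ ⊥ {N} ++ S) ≡ 0ℚ
    head-zero = decidable-stable (c (inside ∷ ⊥ {N} ++ S) ℚ.≟ 0ℚ) λ ne →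
      contradiction (Vec.∷-injectiveˡ (supp (inside ∷ ⊥ {N} ++ S) ne)) λ ()

-- Collapsing along a filtration

p⊆q∧∣q∣≤∣p∣⇒p≡q : ∀ {n} {p q : Subset n} → p ⊆ q → ∣ q ∣ ≤ ∣ p ∣ → p ≡ q
p⊆q∧∣q∣≤∣p∣⇒p≡q {p = p} p⊆q ∣q∣≤∣p∣ = ⊆-antisym p⊆q λ {x} x∈q →
  decidable-stable (x ∈? p) λ x∉p → ℕ.<⇒≱ (p⊂q⇒∣p∣<∣q∣ (p⊆q , x , x∈q , x∉p)) ∣q∣≤∣p∣

-- `K` is filtered by the size of `f σ`. The apex depends on `f σ` only and adding it leaves `f`
-- unchanged, so toggling it matches the simplices of each layer among themselves, down to those
-- with `f σ` empty.
module Filtration (K : SimplicialComplex N) (f : Subset N → Subset M) (f-mono : ∀ {σ ρ} → σ ⊆ ρ → f σ ⊆ f ρ)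
  (apex : Subset M → Fin N)
  (f-apex : ∀ {σ} → Face K σ → Nonempty (f σ) → ∀ ρ → f (ρ ∪ ⁅ apex (f σ) ⁆) ⊆ f ρ)
  (f-⊥ : f ⊥ ≡ ⊥)
  (add : ∀ {σ} → Face K σ → Nonempty (f σ) → Face K (σ ∪ ⁅ apex (f σ) ⁆)) where

  stage : ℕ → SimplicialComplex N
  stage s = record
    { Face   = λ σ → Face K σ × ∣ f σ ∣ ≤ s
    ; face?  = λ σ → face? K σ ×-dec (∣ f σ ∣ ℕ.≤? s)
    ; ⊥-face = ⊥-face K , subst (_≤ s) (sym (trans (cong ∣_∣ f-⊥) (∣⊥∣≡0 M))) z≤n
    ; closed = λ τ⊆σ (g , b) → closed K τ⊆σ g , ℕ.≤-trans (p⊆q⇒∣p∣≤∣q∣ (f-mono τ⊆σ)) b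
    }

  private
    new⇒nonempty : ∀ {s σ} → Face K σ → ¬ Face (stage s) σ → Nonempty (f σ)
    new⇒nonempty g ¬g = 0<∣p∣⇒nonempty (ℕ.≤-<-trans z≤n (ℕ.≰⇒> λ b → ¬g (g , b)))

    matching : ∀ s → Matching (stage (suc s)) (stage s)
    matching s = record
      { apex     = apex ∘ f
      ; add      = λ {σ} (g , b) ¬g → let ne = new⇒nonempty {s} g ¬g in
                   add g ne , ℕ.≤-trans (p⊆q⇒∣p∣≤∣q∣ (f-apex g ne σ)) b
      ; remove   = λ {σ} {ρ} (g , _) ¬g σ⊆ (_ , b) → ¬g (g , ℕ.≤-trans
                   (p⊆q⇒∣p∣≤∣q∣ (f-apex g (new⇒nonempty {s} g ¬g) ρ ∘ f-mono σ⊆)) b)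
      -- Within one layer the sizes of `f σ` and `f ρ` agree, so nested simplices have equal images
      -- under `f`.
      ; constant = λ (g , b) ¬g σ⊆ρ → cong apex (p⊆q∧∣q∣≤∣p∣⇒p≡q (f-mono σ⊆ρ)
                   (ℕ.≤-trans b (ℕ.≰⇒> λ b′ → ¬g (closed K σ⊆ρ g , b′))))
      }

    stage-≼ : ∀ s → stage s ≼ stage (suc s)
    stage-≼ s (g , b) = g , ℕ.m≤n⇒m≤1+n b

    relative : ∀ s → RelativelyAcyclic (stage (suc s)) (stage s)
    relative s = matching⇒relativelyAcyclic (stage (suc s)) (stage s) (matching s)

    lower : ∀ s {r} → Acyclic (stage s) r → Acyclic (stage 0) r
    lower zero    A = A
    lower (suc s) A = lower s (acyclic-restrict (stage (suc s)) (stage s) (stage-≼ s) (relative s) A)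

    raise : ∀ s {r} → Acyclic (stage 0) r → Acyclic (stage s) r
    raise zero    A = A
    raise (suc s) A = acyclic-extend (stage (suc s)) (stage s) (stage-≼ s) (relative s) (raise s A)

  collapse : ∀ {r} → Acyclic K r → Acyclic (stage 0) r
  collapse A = lower M (acyclic-resp K (stage M) (λ {σ} g → g , ∣p∣≤n (f σ)) proj₁ A)

  expand : ∀ {r} → Acyclic (stage 0) r → Acyclic K r
  expand A = acyclic-resp (stage M) K proj₁ (λ {σ} g → g , ∣p∣≤n (f σ)) (raise M A)

-- Order complexes

Meets : SimplicialComplex N → Subset N → Subset N → Set
Meets C W σ = Face C σ × Nonempty (σ ∩ W)

meets : SimplicialComplex N → Subset N → SimplicialComplex (2 ^ N)
meets {N} C W = record
  { Face   = λ S → (∀ x → x ∈ S → Meets C W (decode x))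
                 × (∀ x y → x ∈ S → y ∈ S → Comparable (decode {N} x) (decode {N} y))
  ; face?  = λ S →
      Fin.all? (λ x → (x ∈? S) →-dec (face? C (decode x) ×-dec nonempty? (decode x ∩ W)))
      ×-dec
      Fin.all? (λ x → Fin.all? λ y → map′ (λ f p q → f (p , q)) (λ f (p , q) → f p q)
        (((x ∈? S) ×-dec (y ∈? S)) →-dec ((decode {N} x ⊆? decode {N} y) ⊎-dec (decode {N} y ⊆? decode {N} x))))
  ; ⊥-face = (λ _ x∈⊥ → contradiction x∈⊥ ∉⊥) , (λ _ _ x∈⊥ → contradiction x∈⊥ ∉⊥)
  ; closed = λ τ⊆σ (vs , ch) → (λ x → vs x ∘ τ⊆σ) , (λ x y p q → ch x y (τ⊆σ p) (τ⊆σ q))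
  }

least : ∀ {k} (g : Fin k → Subset N) (S : Subset k) → (∀ x y → x ∈ S → y ∈ S → Comparable (g x) (g y)) →
        Nonempty S → ∃ λ x → x ∈ S × (∀ y → y ∈ S → g x ⊆ g y)
least g (outside ∷ S) ch (suc x , there x∈) =
  let y , y∈ , min = least (g ∘ suc) S (λ x y p q → ch (suc x) (suc y) (there p) (there q)) (x , x∈)
  in suc y , there y∈ , λ { (suc z) (there z∈) → min z z∈ }
least g (inside ∷ S) ch _ with nonempty? S
... | no empty = zero , here , λ { zero _ v∈ → v∈ ; (suc z) (there z∈) → contradiction (z , z∈) empty }
... | yes ne with least (g ∘ suc) S (λ x y p q → ch (suc x) (suc y) (there p) (there q)) ne
...   | y , y∈ , min with ch zero (suc y) here (there y∈)
...     | inj₁ g₀⊆gy = zero , here , λ { zero _ v∈ → v∈ ; (suc z) (there z∈) → min z z∈ ∘ g₀⊆gy }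
...     | inj₂ gy⊆g₀ = suc y , there y∈ , λ { zero _ → gy⊆g₀ ; (suc z) (there z∈) → min z z∈ }

encode : Subset N → Fin (2 ^ N)
encode = Inverse.from code

decode-encode : ∀ (σ : Subset N) → decode (encode σ) ≡ σ
decode-encode = Inverse.strictlyInverseˡ code

-- The cylinder joining a complex to its order complex

module Cylinder (C : SimplicialComplex N) (W : Subset N) where

  left : Subset (N + 2 ^ N) → Subset N
  left = take N

  right : Subset (N + 2 ^ N) → Subset (2 ^ N)
  right = drop N

  Below : Subset N → Subset (2 ^ N) → Set
  Below τ S = ∀ x → x ∈ S → τ ⊆ decode x

  -- The two ends are `C ⟦ W ⟧`, where the right part is empty, and `meets C W`, where the left part
  -- is empty.
  cylinder : SimplicialComplex (N + 2 ^ N)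
  cylinder = record
    { Face   = λ σ → Face (C ⟦ W ⟧) (left σ) × Face (meets C W) (right σ) × Below (left σ) (right σ)
    ; face?  = λ σ → face? (C ⟦ W ⟧) (left σ) ×-dec face? (meets C W) (right σ) ×-dec
                     Fin.all? λ x → (x ∈? right σ) →-dec (left σ ⊆? decode x)
    ; ⊥-face = face-⊥ (C ⟦ W ⟧) (take-⊥ N) , face-⊥ (meets C W) (drop-⊥ N) ,
               λ x x∈ → contradiction (subst (x ∈_) (drop-⊥ N) x∈) ∉⊥
    ; closed = λ τ⊆σ (f , g , b) → closed (C ⟦ W ⟧) (take-mono N τ⊆σ) f , closed (meets C W) (drop-mono N τ⊆σ) g ,
               λ x x∈ → b x (drop-mono N τ⊆σ x∈) ∘ take-mono N τ⊆σ
    }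

  common? : ∀ S → Dec (∃ λ v → v ∈ W × (∀ x → x ∈ S → v ∈ decode x))
  common? S = Fin.any? λ v → (v ∈? W) ×-dec Fin.all? λ x → (x ∈? S) →-dec (v ∈? decode x)

  -- The second clause is a junk value: it does not occur for a nonempty chain in meets C W.
  left-apex : Subset (2 ^ N) → Fin (N + 2 ^ N)
  left-apex S with common? S
  ... | yes (v , _) = v ↑ˡ 2 ^ N
  ... | no _        = N ↑ʳ encode (⊥ {N})

  -- A vertex of `W` in the least member of the chain belongs to all members.
  left-apex-spec : ∀ {S} → Face (meets C W) S → Nonempty S →
    ∃ λ v → left-apex S ≡ v ↑ˡ 2 ^ N × v ∈ W × (∀ x → x ∈ S → v ∈ decode x)
  left-apex-spec {S} (ms , ch) ne with common? S
  ... | yes (v , v∈W , v∈S) = v , refl , v∈W , v∈S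
  ... | no ¬common =
    let x , x∈S , min = least decode S ch ne
        v , v∈x∩W     = proj₂ (ms x x∈S)
        v∈x , v∈W     = x∈p∩q⁻ (decode x) W v∈x∩W
    in contradiction (v , v∈W , λ y y∈S → min y y∈S v∈x) ¬common

  left-fixes-right : ∀ {σ} → Face cylinder σ → Nonempty (right σ) → ∀ ρ →
                     right (ρ ∪ ⁅ left-apex (right σ) ⁆) ⊆ right ρ
  left-fixes-right (_ , g , _) ne ρ = let v , e , _ = left-apex-spec g ne in
    ⊆-reflexive (trans (cong (λ a → right (ρ ∪ ⁅ a ⁆)) e) (drop-∪-↑ˡ ρ v))

  left-add : ∀ {σ} → Face cylinder σ → Nonempty (right σ) → Face cylinder (σ ∪ ⁅ left-apex (right σ) ⁆)
  left-add {σ} ((f , τ⊆W) , g , b) ne with left-apex-spec g ne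
  ... | v , e , v∈W , v∈S = subst (λ a → Face cylinder (σ ∪ ⁅ a ⁆)) (sym e)
      ( subst (Face (C ⟦ W ⟧)) (sym (take-∪-↑ˡ σ v))
          -- The enlarged left part is a simplex of `C` because it is still contained in a member of
          -- the chain.
          ( closed C (below (proj₁ ne) (proj₂ ne)) (proj₁ (proj₁ g (proj₁ ne) (proj₂ ne)))
          , [ τ⊆W , (λ w∈ → subst (_∈ W) (sym (x∈⁅y⁆⇒x≡y v w∈)) v∈W) ]′ ∘ x∈p∪q⁻ (left σ) ⁅ v ⁆ )
      , subst (Face (meets C W)) (sym (drop-∪-↑ˡ σ v)) g
      , λ x x∈ → subst (_⊆ decode x) (sym (take-∪-↑ˡ σ v)) (below x (subst (x ∈_) (drop-∪-↑ˡ σ v) x∈)) )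
    where
    below : Below (left σ ∪ ⁅ v ⁆) (right σ)
    below x x∈ = [ b x x∈ , (λ w∈ → subst (_∈ decode x) (sym (x∈⁅y⁆⇒x≡y v w∈)) (v∈S x x∈)) ]′ ∘ x∈p∪q⁻ (left σ) ⁅ v ⁆

  right-apex : Subset N → Fin (N + 2 ^ N)
  right-apex τ = N ↑ʳ encode τ

  right-fixes-left : ∀ {σ} → Face cylinder σ → Nonempty (left σ) → ∀ ρ →
                     left (ρ ∪ ⁅ right-apex (left σ) ⁆) ⊆ left ρ
  right-fixes-left {σ} _ _ ρ = ⊆-reflexive (take-∪-↑ʳ ρ (encode (left σ)))

  -- The left part `τ` lies below every member, so it extends the chain; being nonempty and
  -- contained in `W`, it meets `W`.
  right-add : ∀ {σ} → Face cylinder σ → Nonempty (left σ) → Face cylinder (σ ∪ ⁅ right-apex (left σ) ⁆)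
  right-add {σ} ((f , τ⊆W) , (ms , ch) , b) (v , v∈τ) =
      subst (Face (C ⟦ W ⟧)) (sym (take-∪-↑ʳ σ y)) (f , τ⊆W)
    , subst (Face (meets C W)) (sym (drop-∪-↑ʳ σ y)) (ms′ , ch′)
    , λ x x∈ → subst (_⊆ decode x) (sym (take-∪-↑ʳ σ y)) (below x (subst (x ∈_) (drop-∪-↑ʳ σ y) x∈))
    where
    τ = left σ
    y = encode τ
    new : ∀ {x} → x ∈ right σ ∪ ⁅ y ⁆ → x ∈ right σ ⊎ decode x ≡ τ
    new x∈ = Sum.map₂ (λ x∈y → trans (cong decode (x∈⁅y⁆⇒x≡y y x∈y)) (decode-encode τ)) (x∈p∪q⁻ (right σ) ⁅ y ⁆ x∈)
    below : Below τ (right σ ∪ ⁅ y ⁆)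
    below x x∈ = [ b x , (λ e → ⊆-reflexive (sym e)) ]′ (new x∈)
    ms′ : ∀ x → x ∈ right σ ∪ ⁅ y ⁆ → Meets C W (decode x)
    ms′ x x∈ = [ ms x , (λ e → subst (Meets C W) (sym e) (f , v , x∈p∩q⁺ (v∈τ , τ⊆W v∈τ))) ]′ (new x∈)
    ch′ : ∀ x x′ → x ∈ right σ ∪ ⁅ y ⁆ → x′ ∈ right σ ∪ ⁅ y ⁆ → Comparable (decode x) (decode x′)
    ch′ x x′ x∈ x′∈ with new x∈ | new x′∈
    ... | inj₂ e  | _       = inj₁ (subst (_⊆ decode x′) (sym e) (below x′ x′∈))
    ... | inj₁ _  | inj₂ e  = inj₂ (subst (_⊆ decode x) (sym e) (below x x∈))
    ... | inj₁ p  | inj₁ p′ = ch x x′ p p′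

  module Left = Filtration cylinder right (drop-mono N) left-apex left-fixes-right (drop-⊥ N) left-add

  module Right = Filtration cylinder left (take-mono N) right-apex right-fixes-left (take-⊥ N) right-add

  ∣p∣≤0⇒p≡⊥ : ∀ {n} {p : Subset n} → ∣ p ∣ ≤ 0 → p ≡ ⊥
  ∣p∣≤0⇒p≡⊥ ∣p∣≤0 = Empty-unique λ ne → ℕ.<⇒≱ (nonempty⇒0<∣p∣ ne) ∣p∣≤0

  -- Read from the inside out: `C ⟦ W ⟧` is a copy of `Left.stage 0`, which expands to the cylinder,
  -- which collapses to `Right.stage 0`, a copy of `meets C W`.
  meets-acyclic : ∀ {r} → Acyclic (C ⟦ W ⟧) r → Acyclic (meets C W) r
  meets-acyclic A =
    acyclic-unembed (right-embedding N (2 ^ N)) (meets C W) (Right.stage 0)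
      (λ {σ} (_ , b) → trans (cong (_++ right σ) (sym (∣p∣≤0⇒p≡⊥ b))) (Vec.take++drop≡id N σ))
      (λ {S} g → ( face-⊥ (C ⟦ W ⟧) (take-++ ⊥ S) , subst (Face (meets C W)) (sym (drop-++ (⊥ {N}) S)) g
                 , λ x _ v∈ → contradiction (subst (_ ∈_) (take-++ ⊥ S) v∈) ∉⊥ )
               , ℕ.≤-reflexive (trans (cong ∣_∣ (take-++ (⊥ {N}) S)) (∣⊥∣≡0 N)))
      (λ {S} ((_ , g , _) , _) → subst (Face (meets C W)) (drop-++ (⊥ {N}) S) g)
      (Right.collapse (Left.expand
        (acyclic-embed (left-embedding N (2 ^ N)) (C ⟦ W ⟧) (Left.stage 0)
          (λ {σ} (_ , b) → trans (cong (left σ ++_) (sym (∣p∣≤0⇒p≡⊥ b))) (Vec.take++drop≡id N σ))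
          (λ {τ} f → ( subst (Face (C ⟦ W ⟧)) (sym (take-++ τ ⊥)) f , face-⊥ (meets C W) (drop-++ τ ⊥)
                     , λ x x∈ → contradiction (subst (x ∈_) (drop-++ τ ⊥) x∈) ∉⊥ )
                   , ℕ.≤-reflexive (trans (cong ∣_∣ (drop-++ τ ⊥)) (∣⊥∣≡0 (2 ^ N))))
          (λ {τ} ((f , _) , _) → subst (Face (C ⟦ W ⟧)) (take-++ τ ⊥) f)
          A)))

-- Unions of classes and colourful chains

∈-⋃⁺ : ∀ {p : Subset N} {L v} → p ∈ₗ L → v ∈ p → v ∈ ⋃ L
∈-⋃⁺ {L = p ∷ L} (Any.here refl) v∈p = p⊆p∪q (⋃ L) v∈p
∈-⋃⁺ {L = q ∷ L} (Any.there p∈L) v∈p = q⊆p∪q q (⋃ L) (∈-⋃⁺ p∈L v∈p)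

∈-⋃⁻ : ∀ (L : List (Subset N)) {v} → v ∈ ⋃ L → ∃ λ p → p ∈ₗ L × v ∈ p
∈-⋃⁻ []      v∈ = contradiction v∈ ∉⊥
∈-⋃⁻ (p ∷ L) v∈ with x∈p∪q⁻ p (⋃ L) v∈
... | inj₁ v∈p = p , Any.here refl , v∈p
... | inj₂ v∈L = let q , q∈L , v∈q = ∈-⋃⁻ L v∈L in q , Any.there q∈L , v∈q

module _ {n} (V : Fin n → Subset N) {I : Subset n} where

  ∈-unionOver⁺ : ∀ {i v} → i ∈ I → v ∈ V i → v ∈ unionOver V I
  ∈-unionOver⁺ {i} i∈I = ∈-⋃⁺ (Mem.∈-map⁺ V (Mem.∈-filter⁺ (_∈? I) (Mem.∈-allFin i) i∈I))

  ∈-unionOver⁻ : ∀ {v} → v ∈ unionOver V I → ∃ λ i → i ∈ I × v ∈ V i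
  ∈-unionOver⁻ v∈ with ∈-⋃⁻ _ v∈
  ... | p , p∈ , v∈p with Mem.∈-map⁻ V p∈
  ...   | i , i∈ , refl = i , proj₂ (Mem.∈-filter⁻ (_∈? I) {xs = allFin n} i∈) , v∈p

module _ {n} (C : SimplicialComplex N) (V : Fin n → Subset N) where

  meets-class : Fin n → SimplicialComplex (2 ^ N)
  meets-class i = meets C (V i)

  -- A chain of simplices meets V i as soon as its least simplex does.
  union-meets : ∀ {I r} → Acyclic (meets C (unionOver V I)) r → Acyclic (union meets-class I) r
  union-meets {I} = acyclic-resp (meets C (unionOver V I)) (union meets-class I) to from
    where
    to : meets C (unionOver V I) ≼ union meets-class I
    to {S} (ms , ch) with nonempty? S
    ... | no empty = inj₁ (Empty-unique empty)
    ... | yes ne   =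
      let x , x∈S , min = least decode S ch ne
          v , v∈        = proj₂ (ms x x∈S)
          v∈x , v∈W     = x∈p∩q⁻ (decode x) (unionOver V I) v∈
          i , i∈I , v∈i = ∈-unionOver⁻ V v∈W
      in inj₂ (i , i∈I , (λ y y∈S → proj₁ (ms y y∈S) , v , x∈p∩q⁺ (min y y∈S v∈x , v∈i)) , ch)
    from : union meets-class I ≼ meets C (unionOver V I)
    from (inj₁ e) = face-⊥ (meets C (unionOver V I)) e
    from (inj₂ (i , i∈I , ms , ch)) =
      (λ x x∈S → let f , v , v∈ = ms x x∈S
                     v∈x , v∈i  = x∈p∩q⁻ (decode x) (V i) v∈
                 in f , v , x∈p∩q⁺ (v∈x , ∈-unionOver⁺ V i∈I v∈i)) , ch

  -- The classes met by every member of a chain are those met by its least member. Counting the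
  -- complexes that contain the chain is therefore counting the classes of the least member, and
  -- larger members meet at least as many.
  threshold-Col : ∀ {k r} → 0 < k → Acyclic (threshold k meets-class) r → Acyclic (Col C V k) r
  threshold-Col {k} 0<k = acyclic-resp (threshold k meets-class) (Col C V k) to from
    where
    class? : ∀ σ i → Dec (Nonempty (σ ∩ V i))
    class? σ i = nonempty? (σ ∩ V i)

    to : threshold k meets-class ≼ Col C V k
    to (inj₁ e) = face-⊥ (Col C V k) e
    to {S} (inj₂ k≤) =
      -- A positive threshold yields one complex containing `S`, from which the chain condition is
      -- read off.
      let i , i∈  = 0<∣p∣⇒nonempty (ℕ.≤-trans 0<k k≤)
          ms , ch = ∈-tabulate⁻ (λ i → face? (meets-class i) S) i∈
      in (λ x x∈S → proj₁ (ms x x∈S) , ℕ.≤-trans k≤ (p⊆q⇒∣p∣≤∣q∣ λ {j} j∈ → ∈-tabulate⁺ (class? (decode x))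
            (proj₂ (proj₁ (∈-tabulate⁻ (λ i → face? (meets-class i) S) j∈) x x∈S)))) , ch

    from : Col C V k ≼ threshold k meets-class
    from {S} (cs , ch) with nonempty? S
    ... | no empty = inj₁ (Empty-unique empty)
    ... | yes ne   =
      let x , x∈S , min = least decode S ch ne in
      inj₂ (ℕ.≤-trans (proj₂ (cs x x∈S)) (p⊆q⇒∣p∣≤∣q∣ λ {i} i∈ → ∈-tabulate⁺ (λ i → face? (meets-class i) S)
        ((λ y y∈S → let v , v∈   = ∈-tabulate⁻ (class? (decode x)) i∈
                        v∈x , v∈i = x∈p∩q⁻ (decode x) (V i) v∈
                    in proj₁ (cs y y∈S) , v , x∈p∩q⁺ (min y y∈S v∈x , v∈i)) , ch)))

  -- The empty simplex is comparable to every simplex, so it is an apex.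
  Col-zero : ∀ r → Acyclic (Col C V 0) r
  Col-zero = cone-acyclic (Col C V 0) (encode (⊥ {N})) λ {S} (cs , ch) →
      (λ x x∈ → [ cs x , (λ e → subst (Colourful C V 0) (sym e) (⊥-face C , z≤n)) ]′ (new S x∈))
    , (λ x y x∈ y∈ → comparable S ch (new S x∈) (new S y∈))
    where
    new : ∀ S {x} → x ∈ S ∪ ⁅ encode (⊥ {N}) ⁆ → x ∈ S ⊎ decode x ≡ ⊥
    new S x∈ = Sum.map₂ (λ x∈a → trans (cong decode (x∈⁅y⁆⇒x≡y (encode (⊥ {N})) x∈a)) (decode-encode ⊥))
      (x∈p∪q⁻ S ⁅ encode (⊥ {N}) ⁆ x∈)
    comparable : ∀ S → (∀ x y → x ∈ S → y ∈ S → Comparable (decode {N} x) (decode {N} y)) →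
      ∀ {x y} → x ∈ S ⊎ decode {N} x ≡ ⊥ → y ∈ S ⊎ decode {N} y ≡ ⊥ → Comparable (decode {N} x) (decode {N} y)
    comparable S ch {x} {y} (inj₂ e) _        = inj₁ (subst (_⊆ decode y) (sym e) ⊥⊆)
    comparable S ch {x} {y} (inj₁ _) (inj₂ e) = inj₂ (subst (_⊆ decode x) (sym e) ⊥⊆)
    comparable S ch (inj₁ p) (inj₁ q)         = ch _ _ p q

-- Bounds on `ηH` as acyclicity, and the conclusion

≤ηH⇒acyclic : ∀ (K : SimplicialComplex N) {s} → [ s ] ≤⁺ ηH K → Acyclic K s
≤ηH⇒acyclic K {s} s≤η = lemma (ηH K) (ηH-spec K) s≤η
  where
  lemma : ∀ h → IsηH K h → [ s ] ≤⁺ h → Acyclic K s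
  lemma _ (A , _) Sup.[ s≤h ] p p<s = A p (ℕ.<-≤-trans p<s s≤h)
  lemma _ A (_ Sup.≤⊤⁺)             = A s

acyclic⇒≤ηH : ∀ (K : SimplicialComplex N) {s} → Acyclic K s → [ s ] ≤⁺ ηH K
acyclic⇒≤ηH K {s} A = lemma (ηH K) (ηH-spec K)
  where
  lemma : ∀ h → IsηH K h → [ s ] ≤⁺ h
  lemma [ h ] (_ , max) = Sup.[ max s A ]
  lemma ⊤⁺    _         = [ s ] Sup.≤⊤⁺

theorem5p8 : ∀ {N n : ℕ} (C : SimplicialComplex N) (V : Fin n → Subset N) → IsPartition C V →
    (m d : ℕ) →
    (∀ (I : Subset n) → Nonempty I → d ≤ ∣ I ∣ →
    [ (∣ I ∣ ∸ d) + m ] ≤⁺ ηH (C ⟦ unionOver V I ⟧)) →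
    [ m + 1 ] ≤⁺ ηH (Col C V (n ∸ d))
theorem5p8 {N} {n} C V _ m d hyp = acyclic⇒≤ηH (Col C V (n ∸ d)) (by-cases (n ∸ d) refl)
  where
  by-cases : ∀ k → n ∸ d ≡ k → Acyclic (Col C V k) (m + 1)
  -- This is the case `n ≤ d`: the empty simplex is then a vertex of `Col` and the complex is a
  -- cone.
  by-cases zero    _  = Col-zero C V (m + 1)
  by-cases (suc k) eq = threshold-Col C V (s≤s z≤n) (subst (Acyclic (threshold (suc k) (meets-class C V))) (ℕ.+-comm 1 m)
    (threshold-acyclic (meets-class C V) k d m
      -- A nonzero difference forces `d < n`, so the truncated subtraction is exact and
      -- `suc k + d ≡ n`.
      (trans (cong (_+ d) (sym eq)) (ℕ.m∸n+n≡m (ℕ.<⇒≤ (ℕ.m∸n≢0⇒n<m {n} {d} λ e → contradiction (trans (sym eq) e) λ ()))))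
      λ I ne d≤ → union-meets C V (Cylinder.meets-acyclic C (unionOver V I)
        (≤ηH⇒acyclic (C ⟦ unionOver V I ⟧) (hyp I ne d≤)))))
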